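{- Let $m \ge 2$ and $n \ge 1$ be integers. Let $G$ be a graph with maximum degree $\Delta \ge 1$ whose vertex set admits a partition $V(G) = U_1 \cup U_2 \cup \dots \cup U_m$ into independent sets with $|U_i| \le n$ for all $i \in [m]$. Let $c$ be a globally $\left(\frac{n}{110\Delta^2}\right)$-bounded coloring of the complete balanced $m$-partite graph $K_{m\otimes n}$. Then $c$ is $G$-rainbow, i.e. the colored graph $K_{m\otimes n}$ contains a rainbow copy of $G$.
   Context: $K_{m\otimes n}$ denotes the complete $m$-partite graph with exactly $n$ vertices in each of its $m$ classes. A coloring of a graph $H$ is an arbitrary edge-coloring $c: E(H)\to\mathbb{N}$ (not necessarily proper). For a real number $k$, a coloring $c$ is globally $k$-bounded if every color is used on at most $k$ edges of $H$. A copy of $G$ in $H$ is a subgraph of $H$ isomorphic to $G$; it is rainbow if all its edges receive pairwise distinct colors. A coloring $c$ of $H$ is $G$-rainbow if $H$ contains a rainbow copy of $G$. -}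

module Defs where

open import Data.Fin using (Fin; _<_; quotient)
open import Data.Fin.Properties using (_≟_; _<?_)
open import Data.Fin.Subset using (Subset; _∈_)
open import Data.Integer using (+_)
open import Data.List using (List; allFin; cartesianProduct; filter; length; map; mapMaybe)
open import Data.List.Extrema.Nat using (max)
open import Data.Maybe using (Maybe; just; nothing)
open import Data.Nat using (ℕ; NonZero; _*_; _^_)
import Data.Nat as ℕ
open import Data.Nat.Properties using (m*n≢0; m^n≢0)
open import Data.Product using (∃-syntax; ∃!; _×_; _,_)
open import Data.Rational using (ℚ; _≤_; _/_)
open import Function.Bundles using (_⇔_)
open import Function.Definitions using (Injective)
open import Level using (0ℓ)
open import Relation.Binary.Core using (Rel)
open import Relation.Binary.Definitions using (Decidable; Irreflexive; Symmetric)
open import Relation.Binary.PropositionalEquality using (_≡_; _≢_; refl; sym)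
open import Relation.Nullary using (¬_; yes; no; ¬?; contradiction)
open import Relation.Unary using (Pred)

-- Finite simple graphs, with vertex set Fin order.
record Graph : Set₁ where
  field
    order      : ℕ
    Adj        : Rel (Fin order) 0ℓ
    adj?       : Decidable Adj
    adj-sym    : Symmetric Adj
    adj-irrefl : Irreflexive _≡_ Adj

  Vertex : Set
  Vertex = Fin order

open Graph using (Vertex)

degree : (G : Graph) → Vertex G → ℕ
degree G v = length (filter (Graph.adj? G v) (allFin (Graph.order G)))

maxDegree : Graph → ℕ
maxDegree G = max 0 (map (degree G) (allFin (Graph.order G)))

Independent : (G : Graph) → Subset (Graph.order G) → Set
Independent G S = ∀ {u v} → u ∈ S → v ∈ S → ¬ Graph.Adj G u v

-- The classes may be empty.
IsPartition : ∀ {k m} → (Fin m → Subset k) → Set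
IsPartition U = ∀ v → ∃! _≡_ (λ i → v ∈ U i)

-- An unordered edge is stored with its endpoints in increasing order.  The
-- proofs are irrelevant, so an edge is determined by its two endpoints.
record Edge (H : Graph) : Set where
  constructor edge
  field
    lo hi  : Vertex H
    .lo<hi : lo < hi
    .adj   : Graph.Adj H lo hi

module _ (H : Graph) where
  open Graph H using (order; adj?)

  toEdge : Vertex H × Vertex H → Maybe (Edge H)
  toEdge (u , v) with u <? v | adj? u v
  ... | yes u<v | yes u~v = just (edge u v u<v u~v)
  ... | _       | _       = nothing

  edges : List (Edge H)
  edges = mapMaybe toEdge (cartesianProduct (allFin order) (allFin order))

-- The complete m-partite graph with n vertices in each class; Fin (m * n) is
-- identified with Fin m × Fin n, and quotient n gives the class of a vertex.
K_⊗_ : ℕ → ℕ → Graph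
K m ⊗ n = record
  { order      = m * n
  ; Adj        = λ u v → quotient {m} n u ≢ quotient {m} n v
  ; adj?       = λ u v → ¬? (quotient {m} n u ≟ quotient {m} n v)
  ; adj-sym    = λ u≁v eq → u≁v (sym eq)
  ; adj-irrefl = λ { refl u≢u → contradiction refl u≢u }
  }

Coloring : Graph → Set
Coloring H = Edge H → ℕ

colorCount : ∀ {H} → Coloring H → ℕ → ℕ
colorCount {H} c i = length (filter (λ e → c e ℕ.≟ i) (edges H))

GloballyBounded : ∀ {H} → ℚ → Coloring H → Set
GloballyBounded k c = ∀ i → + colorCount c i / 1 ≤ k

record Subgraph (H : Graph) : Set₁ where
  field
    Vert     : Pred (Vertex H) 0ℓ
    Adj      : Rel (Vertex H) 0ℓ
    adj-sym  : Symmetric Adj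
    adj⇒Adj  : ∀ {u v} → Adj u v → Graph.Adj H u v
    adj⇒Vert : ∀ {u v} → Adj u v → Vert u × Vert v

-- An isomorphism from G onto S, regarded as a graph on the vertices in Vert.
record Isomorphism (G : Graph) {H : Graph} (S : Subgraph H) : Set where
  open Subgraph S
  field
    to         : Vertex G → Vertex H
    to-Vert    : ∀ a → Vert (to a)
    injective  : Injective _≡_ _≡_ to
    surjective : ∀ {v} → Vert v → ∃[ a ] to a ≡ v
    adj⇔       : ∀ {a b} → Graph.Adj G a b ⇔ Adj (to a) (to b)

_∈E_ : ∀ {H} → Edge H → Subgraph H → Set
e ∈E S = Subgraph.Adj S (Edge.lo e) (Edge.hi e)

IsRainbow : ∀ {H} → Coloring H → Subgraph H → Set
IsRainbow c S = ∀ {e f} → e ∈E S → f ∈E S → e ≢ f → c e ≢ c f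

HasRainbowCopy : ∀ {H} → Graph → Coloring H → Set₁
HasRainbowCopy {H} G c = ∃[ S ] (Isomorphism G {H} S × IsRainbow c S)

instance
  110Δ²≢0 : ∀ {Δ} .{{_ : NonZero Δ}} → NonZero (110 * Δ ^ 2)
  110Δ²≢0 {Δ} = m*n≢0 110 (Δ ^ 2) {{_}} {{m^n≢0 Δ 2}}

{-# OPTIONS --safe #-}

-- Count the class-preserving injections φ : V(G) → V(K m ⊗ n).  For a set S of
-- vertices of G and of K m ⊗ n, let #S be the number of those φ for which no two
-- edges of G, with all their ends and the images of their ends in S, get the
-- same colour.  By induction on |S|, #(S - p) ≤ 8/7 #S for every vertex p; as
-- #∅ > 0, this leaves some rainbow φ for the full set.
--
-- For the induction step, every φ lost when p is put back into S has a pair of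
-- equally coloured edges touching p.  Fixing the images of the ends of both
-- edges costs a factor of about n per end: composing φ with the transposition
-- of b = φ a and any other vertex z of the same class creates no new pair of
-- equally coloured edges once a and b are removed from S.  So a fixed pair
-- contributes at most about (8/7)^8 / n^4 of the total, and there are at most
-- 3 n^4 / 110 relevant pairs, counted with suitable weight: the two edges of G
-- are disjoint, or share one or the other end of the first.
module Submission where

open import Data.Bool using (if_then_else_; true; false)
open import Data.Fin using (Fin; zero; suc; _↑ˡ_; _↑ʳ_; splitAt; combine; quotient; fromℕ<)
import Data.Fin as Fin
open import Data.Fin.Permutation using (Permutation; _⟨$⟩ʳ_; _⟨$⟩ˡ_; inverseˡ; transpose)
open import Data.Fin.Properties using
  ( _≟_; _<?_; <-cmp; <-asym; <-irrefl; all?; any?; splitAt-↑ˡ; splitAt-↑ʳ; fromℕ<-injective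
  ; remQuot-combine; combine-injectiveʳ; combine-monoˡ-<)
open import Data.Fin.Subset using (Subset; inside; outside; ⊤; ∣_∣; ⁅_⁆; _∈_; _∉_; _⊆_; _-_)
open import Data.Fin.Subset.Properties using
  (_∈?_; ∈⊤; nonempty?; p─q⊆p; ∣p─q∣≤∣p∣; x∈p∧x≢y⇒x∈p-y; x∈p⇒∣p-x∣<∣p∣)
import Data.Integer as ℤ
import Data.Integer.Properties as ℤ
open import Data.List using
  (List; []; _∷_; _++_; allFin; cartesianProduct; cartesianProductWith; filter; length; map; mapMaybe)
open import Data.List.Extrema.Nat using (xs≤max)
open import Data.List.Membership.Propositional using (find)
import Data.List.Membership.Propositional as List
open import Data.List.Membership.Propositional.Properties using
  (∈-allFin; ∈-map⁺; ∈-cartesianProduct⁺; ∈-cartesianProductWith⁺)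
open import Data.List.Properties using (length-tabulate; map-tabulate)
open import Data.List.Relation.Unary.All using (All; []; _∷_)
import Data.List.Relation.Unary.All as All
open import Data.List.Relation.Unary.All.Properties using (¬All⇒Any¬)
open import Data.List.Relation.Unary.AllPairs using (AllPairs; []; _∷_)
open import Data.List.Relation.Unary.Any using (here; there)
open import Data.Maybe using (Maybe; just; nothing; maybe)
open import Data.Nat using
  (ℕ; zero; suc; _+_; _*_; _∸_; _^_; _≤_; _<_; _≥_; z≤n; s≤s; NonZero; >-nonZero; >-nonZero⁻¹)
open import Data.Nat.ListAction using (sum)
open import Data.Nat.Properties hiding (_≟_; _<?_; <-cmp; <-asym; <-irrefl)
import Data.Nat.Properties as ℕ
open import Data.Nat.Tactic.RingSolver using (solve-∀)
open import Data.Product using (∃-syntax; _×_; _,_; proj₁; proj₂)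
open import Data.Rational using (_/_)
import Data.Rational as ℚ
import Data.Rational.Properties as ℚ
import Data.Rational.Unnormalised as ℚᵘ
import Data.Rational.Unnormalised.Properties as ℚᵘ
open import Data.Sum using (_⊎_; inj₁; inj₂; [_,_]′)
open import Data.Sum.Properties using (inj₁-injective; inj₂-injective)
open import Data.Vec using (Vec; []; _∷_; lookup; tabulate; here; there)
import Data.Vec as Vec
open import Data.Vec.Properties using (lookup-map; lookup∘tabulate)
open import Function using (_∘_; mk⇔)
open import Level using (0ℓ)
open import Relation.Binary.Definitions using (Tri; tri<; tri≈; tri>)
open import Relation.Binary.PropositionalEquality
open import Relation.Nullary using
  (¬_; Dec; yes; no; does; ¬?; contradiction; recompute; _×-dec_; _⊎-dec_; _→-dec_)
open import Relation.Nullary.Decidable using (decidable-stable; map′)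
open import Relation.Unary using (Pred; Decidable; _∩_)
open import Relation.Unary.Properties using (_∩?_; _∪?_)
open import Defs
open Graph using (Vertex)

import Algebra.Properties.CommutativeMonoid.Sum +-0-commutativeMonoid as Vector

private variable
  A B C : Set
  P Q R : Set
  k N : ℕ

-- Indicators and finite sums of natural numbers

⟦_⟧ : Dec P → ℕ
⟦ d ⟧ = if does d then 1 else 0

⟦⟧-mono : (p : Dec P) (q : Dec Q) → (P → Q) → ⟦ p ⟧ ≤ ⟦ q ⟧
⟦⟧-mono (no _)  _        P⇒Q = z≤n
⟦⟧-mono (yes p) (yes _) P⇒Q = ≤-refl
⟦⟧-mono (yes p) (no ¬q) P⇒Q = contradiction (P⇒Q p) ¬q

⟦⟧-true : (p : Dec P) → P → 1 ≤ ⟦ p ⟧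
⟦⟧-true (yes _) p = ≤-refl
⟦⟧-true (no ¬p) p = contradiction p ¬p

⟦⟧-false : (p : Dec P) → ¬ P → ⟦ p ⟧ ≡ 0
⟦⟧-false (yes p) ¬p = contradiction p ¬p
⟦⟧-false (no _)  ¬p = refl

⟦⟧-≤ : (p : Dec P) {k : ℕ} → (P → 1 ≤ k) → ⟦ p ⟧ ≤ k
⟦⟧-≤ (yes p) P⇒ = P⇒ p
⟦⟧-≤ (no _)  P⇒ = z≤n

⟦⟧-* : (p : Dec P) {j k : ℕ} → (P → j ≤ k) → ⟦ p ⟧ * j ≤ k
⟦⟧-* (yes p) P⇒ = ≤-trans (≤-reflexive (*-identityˡ _)) (P⇒ p)
⟦⟧-* (no _)  P⇒ = z≤n

⟦⟧-positive : (p : Dec P) → 1 ≤ ⟦ p ⟧ → P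
⟦⟧-positive (yes p) _ = p

∑ : List A → (A → ℕ) → ℕ
∑ xs f = sum (map f xs)

syntax ∑ xs (λ x → e) = ∑[ x ∈ xs ] e

∑-mono : ∀ (xs : List A) {f g : A → ℕ} → (∀ x → f x ≤ g x) → ∑ xs f ≤ ∑ xs g
∑-mono []       f≤g = z≤n
∑-mono (x ∷ xs) f≤g = +-mono-≤ (f≤g x) (∑-mono xs f≤g)

∑-cong : ∀ (xs : List A) {f g : A → ℕ} → (∀ x → f x ≡ g x) → ∑ xs f ≡ ∑ xs g
∑-cong []       f≡g = refl
∑-cong (x ∷ xs) f≡g = cong₂ _+_ (f≡g x) (∑-cong xs f≡g)

∑-zero : (xs : List A) → ∑[ x ∈ xs ] 0 ≡ 0
∑-zero []       = refl
∑-zero (x ∷ xs) = ∑-zero xs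

∑-one : (xs : List A) → ∑[ x ∈ xs ] 1 ≡ length xs
∑-one []       = refl
∑-one (x ∷ xs) = cong suc (∑-one xs)

+-interchange : ∀ a b c d → a + b + (c + d) ≡ a + c + (b + d)
+-interchange a b c d = begin
  a + b + (c + d)   ≡⟨ +-assoc a b (c + d) ⟩
  a + (b + (c + d)) ≡⟨ cong (a +_) (+-assoc b c d) ⟨
  a + (b + c + d)   ≡⟨ cong (λ h → a + (h + d)) (+-comm b c) ⟩
  a + (c + b + d)   ≡⟨ cong (a +_) (+-assoc c b d) ⟩
  a + (c + (b + d)) ≡⟨ +-assoc a c (b + d) ⟨
  a + c + (b + d)   ∎
  where open ≡-Reasoning

∑-+ : ∀ (xs : List A) (f g : A → ℕ) → ∑[ x ∈ xs ] (f x + g x) ≡ ∑ xs f + ∑ xs g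
∑-+ []       f g = refl
∑-+ (x ∷ xs) f g = trans (cong (f x + g x +_) (∑-+ xs f g)) (+-interchange (f x) (g x) (∑ xs f) (∑ xs g))

∑-*ˡ : ∀ (xs : List A) k (f : A → ℕ) → ∑[ x ∈ xs ] (k * f x) ≡ k * ∑ xs f
∑-*ˡ []       k f = sym (*-zeroʳ k)
∑-*ˡ (x ∷ xs) k f = trans (cong (k * f x +_) (∑-*ˡ xs k f)) (sym (*-distribˡ-+ k (f x) (∑ xs f)))

∑-*ʳ : ∀ (xs : List A) (f : A → ℕ) k → ∑[ x ∈ xs ] (f x * k) ≡ ∑ xs f * k
∑-*ʳ []       f k = refl
∑-*ʳ (x ∷ xs) f k = trans (cong (f x * k +_) (∑-*ʳ xs f k)) (sym (*-distribʳ-+ k (f x) (∑ xs f)))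

∑-comm : ∀ (xs : List A) (ys : List B) (f : A → B → ℕ) →
         ∑[ x ∈ xs ] ∑[ y ∈ ys ] f x y ≡ ∑[ y ∈ ys ] ∑[ x ∈ xs ] f x y
∑-comm []       ys f = sym (∑-zero ys)
∑-comm (x ∷ xs) ys f = trans (cong (∑ ys (f x) +_) (∑-comm xs ys f)) (sym (∑-+ ys (f x) (λ y → ∑[ x ∈ xs ] f x y)))

∑-++ : ∀ (xs ys : List A) (f : A → ℕ) → ∑ (xs ++ ys) f ≡ ∑ xs f + ∑ ys f
∑-++ []       ys f = refl
∑-++ (x ∷ xs) ys f = trans (cong (f x +_) (∑-++ xs ys f)) (sym (+-assoc (f x) (∑ xs f) (∑ ys f)))

∑-map : ∀ (g : A → B) xs (f : B → ℕ) → ∑ (map g xs) f ≡ ∑ xs (f ∘ g)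
∑-map g []       f = refl
∑-map g (x ∷ xs) f = cong (f (g x) +_) (∑-map g xs f)

∑-cartesianProductWith : ∀ (h : A → B → C) xs ys (f : C → ℕ) →
  ∑ (cartesianProductWith h xs ys) f ≡ ∑[ x ∈ xs ] ∑[ y ∈ ys ] f (h x y)
∑-cartesianProductWith h []       ys f = refl
∑-cartesianProductWith h (x ∷ xs) ys f = trans (∑-++ (map (h x) ys) (cartesianProductWith h xs ys) f)
  (cong₂ _+_ (∑-map (h x) ys f) (∑-cartesianProductWith h xs ys f))

∑-∈ : ∀ {xs : List A} {x} (f : A → ℕ) → x List.∈ xs → f x ≤ ∑ xs f
∑-∈ f (here refl)                = m≤m+n _ _
∑-∈ {xs = y ∷ _} f (there x∈xs) = ≤-trans (∑-∈ f x∈xs) (m≤n+m _ (f y))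

∑-positive : ∀ (xs : List A) (f : A → ℕ) → 1 ≤ ∑ xs f → ∃[ x ] 1 ≤ f x
∑-positive (x ∷ xs) f 1≤ with f x in eq
... | suc _ = x , subst (1 ≤_) (sym eq) (s≤s z≤n)
... | zero  = ∑-positive xs f 1≤

length-filter : ∀ {P : A → Set} (P? : Decidable P) xs → length (filter P? xs) ≡ ∑[ x ∈ xs ] ⟦ P? x ⟧
length-filter P? []       = refl
length-filter P? (x ∷ xs) with does (P? x)
... | true  = cong suc (length-filter P? xs)
... | false = length-filter P? xs

length-filter-mapMaybe : ∀ {P : B → Set} (P? : Decidable P) (f : A → Maybe B) xs →
  length (filter P? (mapMaybe f xs)) ≡ ∑[ x ∈ xs ] maybe (λ y → ⟦ P? y ⟧) 0 (f x)
length-filter-mapMaybe P? f []       = refl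
length-filter-mapMaybe P? f (x ∷ xs) with f x
... | nothing = length-filter-mapMaybe P? f xs
... | just y with does (P? y)
...   | true  = cong suc (length-filter-mapMaybe P? f xs)
...   | false = length-filter-mapMaybe P? f xs

-- The shape of the counting steps below: at most `X` choices of `x`, for each at most `Y` choices
-- of `y`, and a contribution of at most `M` per choice.
∑∑-bound : ∀ (xs : List A) (ys : List B) {P : A → Set} {Q : A → B → Set}
  (P? : ∀ x → Dec (P x)) (Q? : ∀ x y → Dec (Q x y)) {f : A → B → ℕ} {X Y M} →
  (∀ x y → f x y ≤ ⟦ P? x ⟧ * (⟦ Q? x y ⟧ * M)) →
  ∑[ x ∈ xs ] ⟦ P? x ⟧ ≤ X → (∀ x → ∑[ y ∈ ys ] ⟦ Q? x y ⟧ ≤ Y) →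
  ∑[ x ∈ xs ] ∑[ y ∈ ys ] f x y ≤ X * (Y * M)
∑∑-bound xs ys P? Q? {f} {X} {Y} {M} f≤ ∑P≤X ∑Q≤Y = begin
  ∑[ x ∈ xs ] ∑[ y ∈ ys ] f x y                        ≤⟨ ∑-mono xs (λ x → ∑-mono ys (f≤ x)) ⟩
  ∑[ x ∈ xs ] ∑[ y ∈ ys ] (⟦ P? x ⟧ * (⟦ Q? x y ⟧ * M)) ≡⟨ ∑-cong xs (λ x → ∑-*ˡ ys ⟦ P? x ⟧ (λ y → ⟦ Q? x y ⟧ * M)) ⟩
  ∑[ x ∈ xs ] (⟦ P? x ⟧ * ∑[ y ∈ ys ] (⟦ Q? x y ⟧ * M)) ≤⟨ ∑-mono xs (λ x → *-monoʳ-≤ ⟦ P? x ⟧ (inner x)) ⟩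
  ∑[ x ∈ xs ] (⟦ P? x ⟧ * (Y * M))                     ≡⟨ ∑-*ʳ xs (λ x → ⟦ P? x ⟧) (Y * M) ⟩
  ∑[ x ∈ xs ] ⟦ P? x ⟧ * (Y * M)                       ≤⟨ *-monoˡ-≤ (Y * M) ∑P≤X ⟩
  X * (Y * M)                                          ∎
  where
  open ≤-Reasoning
  inner : ∀ x → ∑[ y ∈ ys ] (⟦ Q? x y ⟧ * M) ≤ Y * M
  inner x = ≤-trans (≤-reflexive (∑-*ʳ ys (λ y → ⟦ Q? x y ⟧) M)) (*-monoˡ-≤ M (∑Q≤Y x))

∑-allFin-suc : ∀ {n} (f : Fin (suc n) → ℕ) → ∑ (allFin (suc n)) f ≡ f zero + ∑ (allFin n) (f ∘ suc)
∑-allFin-suc {n} f = cong (λ h → f zero + sum h)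
  (trans (map-tabulate suc f) (sym (map-tabulate (λ i → i) (f ∘ suc))))

∑-≟ : ∀ {n} (i : Fin n) → ∑[ j ∈ allFin n ] ⟦ i ≟ j ⟧ ≡ 1
∑-≟ {suc n} i@zero = trans (∑-allFin-suc λ j → ⟦ i ≟ j ⟧) (cong suc (∑-zero (allFin n)))
∑-≟ {suc n} i@(suc i′) = trans (∑-allFin-suc λ j → ⟦ i ≟ j ⟧)
  (trans (∑-cong (allFin n) (λ j → same (i′ ≟ j))) (∑-≟ i′))
  where
  same : ∀ {j} (d : Dec (i′ ≡ j)) → ⟦ i ≟ suc j ⟧ ≡ ⟦ d ⟧
  same (yes refl) = ≤-antisym (⟦⟧-mono (i ≟ i) (yes refl) λ x → x) (⟦⟧-true (i ≟ i) refl)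
  same (no i′≢j)  = ⟦⟧-false (i ≟ suc _) λ { refl → i′≢j refl }

∑-≟-* : ∀ {n} (i : Fin n) (f : Fin n → ℕ) → f i ≡ ∑[ j ∈ allFin n ] (⟦ i ≟ j ⟧ * f j)
∑-≟-* {n} i f = begin
  f i                                  ≡⟨ *-identityˡ (f i) ⟨
  1 * f i                              ≡⟨ cong (_* f i) (∑-≟ i) ⟨
  (∑[ j ∈ allFin n ] ⟦ i ≟ j ⟧) * f i    ≡⟨ ∑-*ʳ (allFin n) (λ j → ⟦ i ≟ j ⟧) (f i) ⟨
  ∑[ j ∈ allFin n ] (⟦ i ≟ j ⟧ * f i)  ≡⟨ ∑-cong (allFin n) same ⟩
  ∑[ j ∈ allFin n ] (⟦ i ≟ j ⟧ * f j)  ∎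
  where
  open ≡-Reasoning
  same : ∀ j → ⟦ i ≟ j ⟧ * f i ≡ ⟦ i ≟ j ⟧ * f j
  same j with i ≟ j
  ... | yes refl = refl
  ... | no _     = refl

∑-vector : ∀ {n} (f : Fin n → ℕ) → ∑ (allFin n) f ≡ Vector.sum f
∑-vector {zero}  f = refl
∑-vector {suc n} f = trans (∑-allFin-suc f) (cong (f zero +_) (∑-vector (f ∘ suc)))

∑-permute : ∀ {n} (f : Fin n → ℕ) (π : Permutation n n) → ∑ (allFin n) f ≡ ∑[ i ∈ allFin n ] f (π ⟨$⟩ʳ i)
∑-permute f π = trans (∑-vector f) (trans (Vector.sum-permute f π) (sym (∑-vector λ i → f (π ⟨$⟩ʳ i))))

∑-allFin-+ : ∀ a {b} (f : Fin (a + b) → ℕ) →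
             ∑ (allFin (a + b)) f ≡ ∑[ i ∈ allFin a ] f (i ↑ˡ b) + ∑[ j ∈ allFin b ] f (a ↑ʳ j)
∑-allFin-+ zero        f = refl
∑-allFin-+ (suc a) {b} f = begin
  ∑ (allFin (suc a + b)) f                                             ≡⟨ ∑-allFin-suc f ⟩
  f zero + ∑ (allFin (a + b)) (f ∘ suc)                                ≡⟨ cong (f zero +_) (∑-allFin-+ a (f ∘ suc)) ⟩
  f zero + (∑[ i ∈ allFin a ] f (suc (i ↑ˡ b)) + ∑[ j ∈ allFin b ] f (suc a ↑ʳ j)) ≡⟨ +-assoc (f zero) _ _ ⟨
  f zero + ∑[ i ∈ allFin a ] f (suc (i ↑ˡ b)) + ∑[ j ∈ allFin b ] f (suc a ↑ʳ j)
    ≡⟨ cong (_+ ∑[ j ∈ allFin b ] f (suc a ↑ʳ j)) (∑-allFin-suc λ i → f (i ↑ˡ b)) ⟨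
  ∑[ i ∈ allFin (suc a) ] f (i ↑ˡ b) + ∑[ j ∈ allFin b ] f (suc a ↑ʳ j) ∎
  where open ≡-Reasoning

∑-combine : ∀ m {n} (f : Fin (m * n) → ℕ) →
            ∑ (allFin (m * n)) f ≡ ∑[ i ∈ allFin m ] ∑[ j ∈ allFin n ] f (combine i j)
∑-combine zero        f = refl
∑-combine (suc m) {n} f = trans (∑-allFin-+ n f) (trans
  (cong (∑[ j ∈ allFin n ] f (j ↑ˡ (m * n)) +_) (∑-combine m (λ z → f (n ↑ʳ z))))
  (sym (∑-allFin-suc {m} λ i → ∑[ j ∈ allFin n ] f (combine i j))))

length-allFin : ∀ n → length (allFin n) ≡ n
length-allFin n = length-tabulate (λ i → i)

-- Splitting `z` into class and position leaves the single class `i` for each of the `n` positions.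
-- This supplies `class-size` for the host graph.
∑-quotient : ∀ m n (i : Fin m) → ∑[ z ∈ allFin (m * n) ] ⟦ i ≟ quotient {m} n z ⟧ ≡ n
∑-quotient m n i = begin
  ∑[ z ∈ allFin (m * n) ] ⟦ i ≟ quotient {m} n z ⟧                        ≡⟨ ∑-combine m (λ z → ⟦ i ≟ quotient {m} n z ⟧) ⟩
  ∑[ k ∈ allFin m ] ∑[ j ∈ allFin n ] ⟦ i ≟ quotient {m} n (combine k j) ⟧
    ≡⟨ ∑-cong (allFin m) (λ k → ∑-cong (allFin n) λ j → cong (λ h → ⟦ i ≟ proj₁ h ⟧) (remQuot-combine k j)) ⟩
  ∑[ k ∈ allFin m ] ∑[ j ∈ allFin n ] ⟦ i ≟ k ⟧                          ≡⟨ ∑-comm (allFin m) (allFin n) (λ k _ → ⟦ i ≟ k ⟧) ⟩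
  ∑[ j ∈ allFin n ] ∑[ k ∈ allFin m ] ⟦ i ≟ k ⟧                          ≡⟨ ∑-cong (allFin n) (λ _ → ∑-≟ i) ⟩
  ∑[ j ∈ allFin n ] 1                                                   ≡⟨ ∑-one (allFin n) ⟩
  length (allFin n)                                                     ≡⟨ length-allFin n ⟩
  n                                                                     ∎
  where open ≡-Reasoning

∑-∈? : ∀ {n} (p : Subset n) → ∑[ i ∈ allFin n ] ⟦ i ∈? p ⟧ ≡ ∣ p ∣
∑-∈? Vec.[] = refl
∑-∈? {suc n} (s Vec.∷ p) = trans (∑-allFin-suc λ i → ⟦ i ∈? (s Vec.∷ p) ⟧) (trans
  (cong₂ _+_ refl (trans (∑-cong (allFin n) (λ i → same s i)) (∑-∈? p))) (size s))
  where
  same : ∀ s i → ⟦ suc i ∈? (s Vec.∷ p) ⟧ ≡ ⟦ i ∈? p ⟧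
  same s i = ≤-antisym (⟦⟧-mono (suc i ∈? (s Vec.∷ p)) (i ∈? p) λ { (Vec.there q) → q })
                       (⟦⟧-mono (i ∈? p) (suc i ∈? (s Vec.∷ p)) Vec.there)
  size : ∀ s → ⟦ zero ∈? (s Vec.∷ p) ⟧ + ∣ p ∣ ≡ ∣ s Vec.∷ p ∣
  size inside  = refl
  size outside = refl

-- Placements and switching

maps : ∀ N k → List (Vec (Fin N) k)
maps N zero    = [] ∷ []
maps N (suc k) = cartesianProductWith _∷_ (allFin N) (maps N k)

∈-maps : (φ : Vec (Fin N) k) → φ List.∈ maps N k
∈-maps []      = here refl
∈-maps (b ∷ φ) = ∈-cartesianProductWith⁺ _∷_ (∈-allFin b) (∈-maps φ)

-- By induction on `k`, one image at a time: permuting the first image only reorders the outer sum.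
-- Hence composition with a transposition preserves counts.
∑-maps-permute : ∀ (π : Permutation N N) k (f : Vec (Fin N) k → ℕ) →
                 ∑[ φ ∈ maps N k ] f (Vec.map (π ⟨$⟩ʳ_) φ) ≡ ∑ (maps N k) f
∑-maps-permute     π zero    f = refl
∑-maps-permute {N} π (suc k) f = begin
  ∑[ φ ∈ maps N (suc k) ] f (Vec.map (π ⟨$⟩ʳ_) φ)
    ≡⟨ ∑-cartesianProductWith _∷_ (allFin N) (maps N k) (λ φ → f (Vec.map (π ⟨$⟩ʳ_) φ)) ⟩
  ∑[ b ∈ allFin N ] ∑[ φ ∈ maps N k ] f ((π ⟨$⟩ʳ b) ∷ Vec.map (π ⟨$⟩ʳ_) φ)
    ≡⟨ ∑-cong (allFin N) (λ b → ∑-maps-permute π k (λ φ → f ((π ⟨$⟩ʳ b) ∷ φ))) ⟩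
  ∑[ b ∈ allFin N ] ∑[ φ ∈ maps N k ] f ((π ⟨$⟩ʳ b) ∷ φ)
    ≡⟨ ∑-permute (λ b → ∑[ φ ∈ maps N k ] f (b ∷ φ)) π ⟨
  ∑[ b ∈ allFin N ] ∑[ φ ∈ maps N k ] f (b ∷ φ)
    ≡⟨ ∑-cartesianProductWith _∷_ (allFin N) (maps N k) f ⟨
  ∑ (maps N (suc k)) f ∎
  where open ≡-Reasoning

module _ {N k : ℕ} where
  Map : Set
  Map = Vec (Fin N) k

  opaque
    -- Opaque, so that a count is unfolded into a sum over all maps only in the basic lemmas that
    -- follow.
    # : {P : Pred Map 0ℓ} → Decidable P → ℕ
    # P? = ∑[ φ ∈ maps N k ] ⟦ P? φ ⟧

  module _ {P : Pred Map 0ℓ} (P? : Decidable P) where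

    opaque
      unfolding #

      #-mono : {Q : Pred Map 0ℓ} (Q? : Decidable Q) → (∀ φ → P φ → Q φ) → # P? ≤ # Q?
      #-mono Q? P⊆Q = ∑-mono (maps N k) λ φ → ⟦⟧-mono (P? φ) (Q? φ) (P⊆Q φ)

      #-empty : (∀ φ → ¬ P φ) → # P? ≡ 0
      #-empty ¬P = trans (∑-cong (maps N k) λ φ → ⟦⟧-false (P? φ) (¬P φ)) (∑-zero (maps N k))

      #-∪ : {Q R : Pred Map 0ℓ} (Q? : Decidable Q) (R? : Decidable R) →
            (∀ φ → P φ → Q φ ⊎ R φ) → # P? ≤ # Q? + # R?
      #-∪ Q? R? P⊆Q∪R = ≤-trans (∑-mono (maps N k) λ φ → ⟦⟧-≤ (P? φ) λ p →
          [ (λ q → ≤-trans (⟦⟧-true (Q? φ) q) (m≤m+n _ _)) , (λ r → ≤-trans (⟦⟧-true (R? φ) r) (m≤n+m _ _)) ]′ (P⊆Q∪R φ p))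
        (≤-reflexive (∑-+ (maps N k) (λ φ → ⟦ Q? φ ⟧) (λ φ → ⟦ R? φ ⟧)))

      #-inhabited : ∀ {φ} → P φ → 1 ≤ # P?
      #-inhabited {φ} p = ≤-trans (⟦⟧-true (P? φ) p) (∑-∈ (λ φ → ⟦ P? φ ⟧) (∈-maps φ))

      -- The union bound, with two indices because events are described by two successive choices.
      #-⋃ : ∀ {I J : Set} (xs : List I) (ys : List J) {Q : I → J → Pred Map 0ℓ} (Q? : ∀ i j → Decidable (Q i j)) →
            (∀ φ → P φ → ∃[ i ] ∃[ j ] (i List.∈ xs × j List.∈ ys × Q i j φ)) →
            # P? ≤ ∑[ i ∈ xs ] ∑[ j ∈ ys ] # (Q? i j)
      #-⋃ xs ys Q? P⊆⋃Q = begin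
        # P?                                                         ≤⟨ ∑-mono (maps N k) pointwise ⟩
        ∑[ φ ∈ maps N k ] ∑[ i ∈ xs ] ∑[ j ∈ ys ] ⟦ Q? i j φ ⟧        ≡⟨ ∑-comm (maps N k) xs (λ φ i → ∑[ j ∈ ys ] ⟦ Q? i j φ ⟧) ⟩
        ∑[ i ∈ xs ] ∑[ φ ∈ maps N k ] ∑[ j ∈ ys ] ⟦ Q? i j φ ⟧        ≡⟨ ∑-cong xs (λ i → ∑-comm (maps N k) ys (λ φ j → ⟦ Q? i j φ ⟧)) ⟩
        ∑[ i ∈ xs ] ∑[ j ∈ ys ] # (Q? i j)                           ∎
        where
        open ≤-Reasoning
        pointwise : ∀ φ → ⟦ P? φ ⟧ ≤ ∑[ i ∈ xs ] ∑[ j ∈ ys ] ⟦ Q? i j φ ⟧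
        pointwise φ = ⟦⟧-≤ (P? φ) λ p → let i , j , i∈ , j∈ , q = P⊆⋃Q φ p in
          ≤-trans (⟦⟧-true (Q? i j φ) q) (≤-trans (∑-∈ (λ j → ⟦ Q? i j φ ⟧) j∈) (∑-∈ (λ i → ∑[ j ∈ ys ] ⟦ Q? i j φ ⟧) i∈))

      #-positive : 1 ≤ # P? → ∃[ φ ] P φ
      #-positive 1≤ = let φ , 1≤φ = ∑-positive (maps N k) (λ φ → ⟦ P? φ ⟧) 1≤ in φ , ⟦⟧-positive (P? φ) 1≤φ

      -- The conditions `A` and `B` do not depend on `φ`: if one of them fails, nothing is counted,
      -- so the bound has to be shown only when both hold.
      #-static : ∀ {A B : Set} (A? : Dec A) (B? : Dec B) {L M} → (∀ φ → P φ → A × B) →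
                 (A → B → L * # P? ≤ M) → L * # P? ≤ ⟦ A? ⟧ * (⟦ B? ⟧ * M)
      #-static (yes a) (yes b) P⇒ bound = ≤-trans (bound a b) (≤-reflexive (sym (trans (*-identityˡ _) (*-identityˡ _))))
      #-static (no ¬a) _       {L} P⇒ bound rewrite #-empty (λ φ p → ¬a (proj₁ (P⇒ φ p))) = ≤-reflexive (*-zeroʳ L)
      #-static (yes _) (no ¬b) {L} P⇒ bound rewrite #-empty (λ φ p → ¬b (proj₂ (P⇒ φ p))) = ≤-reflexive (*-zeroʳ L)

      -- The events "φ sends a to z" are disjoint for distinct z.
      #-partition : ∀ a → ∑[ z ∈ allFin N ] # (P? ∩? (λ φ → lookup φ a ≟ z)) ≤ # P?
      #-partition a = ≤-trans (≤-reflexive (∑-comm (allFin N) (maps N k)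
          (λ z φ → ⟦ (P? ∩? (λ φ → lookup φ a ≟ z)) φ ⟧)))
          (∑-mono (maps N k) pointwise)
        where
        pointwise : ∀ φ → ∑[ z ∈ allFin N ] ⟦ (P? ∩? (λ φ → lookup φ a ≟ z)) φ ⟧ ≤ ⟦ P? φ ⟧
        pointwise φ = begin
          ∑[ z ∈ allFin N ] ⟦ (P? ∩? (λ φ → lookup φ a ≟ z)) φ ⟧
            ≤⟨ ∑-mono (allFin N) (λ z → ⟦⟧-≤ ((P? ∩? (λ φ → lookup φ a ≟ z)) φ) λ (p , eq) →
                 *-mono-≤ {x = 1} {u = 1} (⟦⟧-true (lookup φ a ≟ z) eq) (⟦⟧-true (P? φ) p)) ⟩
          ∑[ z ∈ allFin N ] (⟦ lookup φ a ≟ z ⟧ * ⟦ P? φ ⟧) ≡⟨ ∑-≟-* (lookup φ a) (λ _ → ⟦ P? φ ⟧) ⟨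
          ⟦ P? φ ⟧ ∎
          where open ≤-Reasoning

      -- Composition with `π` is a bijection on all maps, so it embeds the placings counted on the
      -- left into those counted on the right.
      #-permute : ∀ {Q : Pred Map 0ℓ} (Q? : Decidable Q) (π : Permutation N N) →
                  (∀ φ → P φ → Q (Vec.map (π ⟨$⟩ʳ_) φ)) → # P? ≤ # Q?
      #-permute Q? π P⇒Q = ≤-trans (∑-mono (maps N k) λ φ → ⟦⟧-mono (P? φ) (Q? (Vec.map (π ⟨$⟩ʳ_) φ)) (P⇒Q φ))
        (≤-reflexive (∑-maps-permute π k (λ φ → ⟦ Q? φ ⟧)))

transpose-left : ∀ (i j : Fin N) → transpose i j ⟨$⟩ʳ i ≡ j
transpose-left i j with i ≟ i
... | yes _  = refl
... | no i≢i = contradiction refl i≢i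

transpose-fix : ∀ (i j : Fin N) {l} → l ≢ i → l ≢ j → transpose i j ⟨$⟩ʳ l ≡ l
transpose-fix i j {l} l≢i l≢j with l ≟ i
... | yes l≡i = contradiction l≡i l≢i
... | no _ with l ≟ j
...   | yes l≡j = contradiction l≡j l≢j
...   | no _    = refl

transpose-cases : ∀ (i j l : Fin N) →
  (transpose i j ⟨$⟩ʳ l ≡ j × l ≡ i) ⊎ (transpose i j ⟨$⟩ʳ l ≡ i × l ≡ j) ⊎ transpose i j ⟨$⟩ʳ l ≡ l
transpose-cases i j l with l ≟ i
... | yes l≡i = inj₁ (refl , l≡i)
... | no _ with l ≟ j
...   | yes l≡j = inj₂ (inj₁ (refl , l≡j))
...   | no _    = inj₂ (inj₂ refl)

permutation-injective : ∀ (π : Permutation N N) {i j} → π ⟨$⟩ʳ i ≡ π ⟨$⟩ʳ j → i ≡ j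
permutation-injective π {i} {j} eq = begin
  i                     ≡⟨ inverseˡ π ⟨
  _                     ≡⟨ cong (π ⟨$⟩ˡ_) eq ⟩
  _                     ≡⟨ inverseˡ π ⟩
  j                     ∎
  where open ≡-Reasoning

x∉p-x : ∀ {n} (p : Subset n) x → x ∉ p - x
x∉p-x (_ ∷ p) (suc x) (there x∈) = x∉p-x p x x∈

-- The host graph enters only through the classes of its vertices and a symmetric colour function.
-- The latter is total on pairs, so that colours can be compared without adjacency proofs.
module Placement (G : Graph) {N m : ℕ} (class : Vertex G → Fin m) (classᴴ : Fin N → Fin m)
                 (col : Fin N → Fin N → ℕ) (col-sym : ∀ b b′ → col b b′ ≡ col b′ b) where
  open Graph G using (order; Adj; adj?; adj-sym; adj-irrefl)

  Placing : Set
  Placing = Vec (Fin N) order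

  -- The disjoint union of both vertex sets: `v ↑ˡ N` stands for a vertex of `G` and `order ↑ʳ b`
  -- for a vertex of the host, so one operation `S - p` removes either kind.
  Point : Set
  Point = Fin (order + N)

  -- Edges are ordered pairs of ends here; the two negations together say that the unordered edges
  -- are different.
  Clash : Placing → (v u x y : Vertex G) → Set
  Clash φ v u x y = Adj v u × Adj x y × ¬ (v ≡ x × u ≡ y) × ¬ (v ≡ y × u ≡ x) ×
                    col (lookup φ v) (lookup φ u) ≡ col (lookup φ x) (lookup φ y)

  clash? : ∀ φ v u x y → Dec (Clash φ v u x y)
  clash? φ v u x y = adj? v u ×-dec adj? x y ×-dec ¬? ((v ≟ x) ×-dec (u ≟ y)) ×-dec ¬? ((v ≟ y) ×-dec (u ≟ x)) ×-dec
                     (_ ℕ.≟ _)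

  clash-flip : ∀ {φ v u x y} → Clash φ v u x y → Clash φ u v x y
  clash-flip (v~u , x~y , ≢₁ , ≢₂ , eq) =
    adj-sym v~u , x~y , (λ (p , q) → ≢₂ (q , p)) , (λ (p , q) → ≢₁ (q , p)) , trans (col-sym _ _) eq

  clash-swap : ∀ {φ v u x y} → Clash φ v u x y → Clash φ x y v u
  clash-swap (v~u , x~y , ≢₁ , ≢₂ , eq) =
    x~y , v~u , (λ (p , q) → ≢₁ (sym p , sym q)) , (λ (p , q) → ≢₂ (sym q , sym p)) , sym eq

  clash-cong : ∀ {φ ψ v u x y} → lookup φ v ≡ lookup ψ v → lookup φ u ≡ lookup ψ u →
               lookup φ x ≡ lookup ψ x → lookup φ y ≡ lookup ψ y → Clash φ v u x y → Clash ψ v u x y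
  clash-cong v≡ u≡ x≡ y≡ (v~u , x~y , ≢₁ , ≢₂ , eq) =
    v~u , x~y , ≢₁ , ≢₂ , trans (sym (cong₂ col v≡ u≡)) (trans eq (cong₂ col x≡ y≡))

  -- A set S of points contains vertices of both graphs; a vertex of G is inside
  -- S when both it and its image belong to S.
  Inside : Subset (order + N) → Placing → Vertex G → Set
  Inside S φ v = (v ↑ˡ N) ∈ S × (order ↑ʳ lookup φ v) ∈ S

  Conflict : Subset (order + N) → Placing → (v u x y : Vertex G) → Set
  Conflict S φ v u x y = Clash φ v u x y × Inside S φ v × Inside S φ u × Inside S φ x × Inside S φ y

  Free : Subset (order + N) → Pred Placing 0ℓ
  Free S φ = ∀ v u x y → ¬ Conflict S φ v u x y

  inside? : ∀ S φ v → Dec (Inside S φ v)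
  inside? S φ v = (_ ∈? S) ×-dec (_ ∈? S)

  conflict? : ∀ S φ v u x y → Dec (Conflict S φ v u x y)
  conflict? S φ v u x y = clash? φ v u x y ×-dec inside? S φ v ×-dec inside? S φ u ×-dec inside? S φ x ×-dec inside? S φ y

  free? : ∀ S → Decidable (Free S)
  free? S φ = all? λ v → all? λ u → all? λ x → all? λ y → ¬? (conflict? S φ v u x y)

  Valid : Pred Placing 0ℓ
  Valid φ = (∀ v u → lookup φ v ≡ lookup φ u → v ≡ u) × (∀ v → classᴴ (lookup φ v) ≡ class v)

  valid? : Decidable Valid
  valid? φ = all? (λ v → all? λ u → (lookup φ v ≟ lookup φ u) →-dec (v ≟ u)) ×-dec all? (λ v → classᴴ (lookup φ v) ≟ class v)

  -- Validity concerns all vertices and only conflicts are restricted to `S`. So every valid placing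
  -- is ok for the empty set, and an ok placing for `⊤` is rainbow.
  record Ok (S : Subset (order + N)) (φ : Placing) : Set where
    constructor ok
    field
      valid : Valid φ
      free  : Free S φ

  Fix : List (Vertex G × Fin N) → Pred Placing 0ℓ
  Fix As φ = All (λ (a , b) → lookup φ a ≡ b) As

  opaque
    ok? : ∀ S → Decidable (Ok S)
    ok? S φ = map′ (λ (valid , free) → ok valid free) (λ (ok valid free) → valid , free) (valid? φ ×-dec free? S φ)

    fix? : ∀ As → Decidable (Fix As)
    fix? As φ = All.all? (λ (a , b) → lookup φ a ≟ b) As

  free-antitone : ∀ {S T} → S ⊆ T → ∀ φ → Free T φ → Free S φ
  free-antitone S⊆T φ free v u x y (cl , v∈ , u∈ , x∈ , y∈) = free v u x y (cl , up v∈ , up u∈ , up x∈ , up y∈)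
    where
    up : ∀ {w} → Inside _ φ w → Inside _ φ w
    up (p , q) = S⊆T p , S⊆T q


  -- If `z` is already the image of some vertex, that vertex moves to `b`. Since `z` and `b` lie in
  -- the same class, classes are respected, and injectivity survives because `π` is a bijection.
  module Switching (φ : Placing) (valid : Valid φ) (a : Vertex G) (z : Fin N) (z-class : classᴴ z ≡ class a) where
    private
      b = lookup φ a
      π = transpose b z

    switched : Placing
    switched = Vec.map (π ⟨$⟩ʳ_) φ

    lookup-switched : ∀ v → lookup switched v ≡ π ⟨$⟩ʳ lookup φ v
    lookup-switched v = lookup-map v (π ⟨$⟩ʳ_) φ

    switched-a : lookup switched a ≡ z
    switched-a = trans (lookup-switched a) (transpose-left b z)

    switched-fix : ∀ {v} → v ≢ a → lookup φ v ≢ z → lookup switched v ≡ lookup φ v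
    switched-fix v≢a φv≢z = trans (lookup-switched _) (transpose-fix b z (v≢a ∘ proj₁ valid _ _) φv≢z)

    switched-valid : Valid switched
    switched-valid = inj , cls
      where
      inj : ∀ v u → lookup switched v ≡ lookup switched u → v ≡ u
      inj v u eq = proj₁ valid v u (permutation-injective π
        (trans (sym (lookup-switched v)) (trans eq (lookup-switched u))))
      cls : ∀ v → classᴴ (lookup switched v) ≡ class v
      cls v with transpose-cases b z (lookup φ v)
      ... | inj₁ (eq , φv≡b) = begin
        classᴴ (lookup switched v) ≡⟨ cong classᴴ (trans (lookup-switched v) eq) ⟩
        classᴴ z                   ≡⟨ z-class ⟩
        class a                    ≡⟨ cong class (proj₁ valid v a φv≡b) ⟨
        class v                    ∎
        where open ≡-Reasoning
      ... | inj₂ (inj₁ (eq , φv≡z)) = begin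
        classᴴ (lookup switched v) ≡⟨ cong classᴴ (trans (lookup-switched v) eq) ⟩
        classᴴ b                   ≡⟨ proj₂ valid a ⟩
        class a                    ≡⟨ z-class ⟨
        classᴴ z                   ≡⟨ cong classᴴ φv≡z ⟨
        classᴴ (lookup φ v)        ≡⟨ proj₂ valid v ⟩
        class v                    ∎
        where open ≡-Reasoning
      ... | inj₂ (inj₂ eq) = trans (cong classᴴ (trans (lookup-switched v) eq)) (proj₂ valid v)

    -- Removing a and b from S makes the switched placing agree with φ inside S.
    switched-free : ∀ S → Free S φ → Free (S - (a ↑ˡ N) - (order ↑ʳ b)) switched
    switched-free S free v u x y (clash , v∈ , u∈ , x∈ , y∈) = free v u x y
      ( clash-cong {φ = switched} {ψ = φ} (agree v∈) (agree u∈) (agree x∈) (agree y∈) clash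
      , up v∈ , up u∈ , up x∈ , up y∈)
      where
      S′ = S - (a ↑ˡ N) - (order ↑ʳ b)
      S′⊆S : S′ ⊆ S
      S′⊆S = p─q⊆p _ _ ∘ p─q⊆p _ _
      agree : ∀ {w} → Inside S′ switched w → lookup switched w ≡ lookup φ w
      agree {w} (w∈ , ψw∈) with transpose-cases b z (lookup φ w)
      -- Only two vertices can move: `a` itself, which is not in `S′`, and the one sent from `z` to
      -- `b`, whose new image is not in `S′`.
      ... | inj₁ (_ , φw≡b) = contradiction
        (subst (λ w → (w ↑ˡ N) ∈ S - (a ↑ˡ N)) (proj₁ valid w a φw≡b) (p─q⊆p _ _ w∈)) (x∉p-x S _)
      ... | inj₂ (inj₁ (eq , _)) = contradiction
        (subst (λ c → (order ↑ʳ c) ∈ S′) (trans (lookup-switched w) eq) ψw∈) (x∉p-x _ _)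
      ... | inj₂ (inj₂ eq) = trans (lookup-switched w) eq
      up : ∀ {w} → Inside S′ switched w → Inside S φ w
      up {w} i@(w∈ , ψw∈) = S′⊆S w∈ , subst (λ c → (order ↑ʳ c) ∈ S) (agree {w} i) (S′⊆S ψw∈)

  module _ {n : ℕ} (class-size : ∀ i → ∑[ z ∈ allFin N ] ⟦ i ≟ classᴴ z ⟧ ≡ n) where

    -- The admissible targets of a switch: avoiding the prescribed images keeps the pairs in `As`
    -- fixed.
    Available : Vertex G → List (Vertex G × Fin N) → Fin N → Set
    Available a As z = class a ≡ classᴴ z × All (λ p → proj₂ p ≢ z) As

    available? : ∀ a As z → Dec (Available a As z)
    available? a As z = (class a ≟ classᴴ z) ×-dec All.all? (λ p → ¬? (proj₂ p ≟ z)) As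

    -- The class of `a` has `n` vertices, and each pair in `As` rules out at most one of them.
    available : ∀ a As → n ∸ length As ≤ ∑[ z ∈ allFin N ] ⟦ available? a As z ⟧
    available a As = m≤n+o⇒m∸n≤o n (length As) (begin
      n                                                                                 ≡⟨ class-size (class a) ⟨
      ∑[ z ∈ allFin N ] ⟦ class a ≟ classᴴ z ⟧                                          ≤⟨ ∑-mono (allFin N) pointwise ⟩
      ∑[ z ∈ allFin N ] (∑[ p ∈ As ] ⟦ proj₂ p ≟ z ⟧ + ⟦ available? a As z ⟧)           ≡⟨ ∑-+ (allFin N) _ _ ⟩
      ∑[ z ∈ allFin N ] ∑[ p ∈ As ] ⟦ proj₂ p ≟ z ⟧ + ∑[ z ∈ allFin N ] ⟦ available? a As z ⟧
        ≡⟨ cong (_+ ∑[ z ∈ allFin N ] ⟦ available? a As z ⟧) used ⟩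
      length As + ∑[ z ∈ allFin N ] ⟦ available? a As z ⟧                               ∎)
      where
      open ≤-Reasoning
      used : ∑[ z ∈ allFin N ] ∑[ p ∈ As ] ⟦ proj₂ p ≟ z ⟧ ≡ length As
      used = trans (∑-comm (allFin N) As (λ z p → ⟦ proj₂ p ≟ z ⟧))
                   (trans (∑-cong As (λ p → ∑-≟ (proj₂ p))) (∑-one As))
      pointwise : ∀ z → ⟦ class a ≟ classᴴ z ⟧ ≤ ∑[ p ∈ As ] ⟦ proj₂ p ≟ z ⟧ + ⟦ available? a As z ⟧
      pointwise z = ⟦⟧-≤ (class a ≟ classᴴ z) λ eq → case-split As eq
        where
        case-split : ∀ As → class a ≡ classᴴ z → 1 ≤ ∑[ p ∈ As ] ⟦ proj₂ p ≟ z ⟧ + ⟦ available? a As z ⟧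
        case-split As eq with All.all? (λ p → ¬? (proj₂ p ≟ z)) As
        ... | yes z∉As = ≤-trans (⟦⟧-true ((class a ≟ classᴴ z) ×-dec yes z∉As) (eq , z∉As)) (m≤n+m _ (∑[ p ∈ As ] ⟦ proj₂ p ≟ z ⟧))
        ... | no ¬z∉As with p , p∈As , ¬¬eq ← find (¬All⇒Any¬ (λ p → ¬? (proj₂ p ≟ z)) As ¬z∉As) =
          ≤-trans (⟦⟧-true (proj₂ p ≟ z) (decidable-stable (proj₂ p ≟ z) ¬¬eq))
                  (≤-trans (∑-∈ (λ p → ⟦ proj₂ p ≟ z ⟧) p∈As) (m≤m+n _ _))

    -- For each available `z`, switching is injective on placings, turns `a ↦ b` into `a ↦ z` and
    -- leaves the pairs in `As` alone. The results for distinct `z` are disjoint, so that many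
    -- copies of the left-hand family fit into the right-hand one.
    switch : ∀ S a b As → All (λ p → proj₁ p ≢ a) As →
             (n ∸ length As) * # (ok? S ∩? fix? ((a , b) ∷ As)) ≤ # (ok? (S - (a ↑ˡ N) - (order ↑ʳ b)) ∩? fix? As)
    switch S a b As a∉As = begin
      (n ∸ length As) * F                                            ≤⟨ *-monoˡ-≤ F (available a As) ⟩
      ∑[ z ∈ allFin N ] ⟦ available? a As z ⟧ * F                    ≡⟨ ∑-*ʳ (allFin N) (λ z → ⟦ available? a As z ⟧) F ⟨
      ∑[ z ∈ allFin N ] (⟦ available? a As z ⟧ * F)                  ≤⟨ ∑-mono (allFin N) (λ z → ⟦⟧-* (available? a As z) (move z)) ⟩
      ∑[ z ∈ allFin N ] # (Q? ∩? (λ φ → lookup φ a ≟ z))              ≤⟨ #-partition Q? a ⟩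
      # Q?                                                           ∎
      where
      open ≤-Reasoning
      P? = ok? S ∩? fix? ((a , b) ∷ As)
      F = # P?
      Q? = ok? (S - (a ↑ˡ N) - (order ↑ʳ b)) ∩? fix? As
      move : ∀ z → Available a As z → F ≤ # (Q? ∩? (λ φ → lookup φ a ≟ z))
      move z (z-class , z∉As) = #-permute P? (Q? ∩? (λ φ → lookup φ a ≟ z)) (transpose b z) step
        where
        step : ∀ φ → (Ok S ∩ Fix ((a , b) ∷ As)) φ →
               ((Ok (S - (a ↑ˡ N) - (order ↑ʳ b)) ∩ Fix As) ∩ (λ φ → lookup φ a ≡ z)) (Vec.map (transpose b z ⟨$⟩ʳ_) φ)
        step φ (ok valid free , refl ∷ fix) = (ok switched-valid (switched-free S free) , fixed As a∉As z∉As fix) , switched-a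
          where
          open Switching φ valid a z (sym z-class)
          fixed : ∀ As → All (λ p → proj₁ p ≢ a) As → All (λ p → proj₂ p ≢ z) As → Fix As φ → Fix As switched
          fixed []       []           []           []           = []
          fixed (_ ∷ As) (≢a ∷ ≢as) (≢z ∷ ≢zs) (refl ∷ fix) = switched-fix ≢a ≢z ∷ fixed As ≢as ≢zs fix

-- Union bounds with two successive choices

⟦⟧-× : {P Q R : Set} (p : Dec P) (q : Dec Q) (r : Dec R) → (P → Q × R) → ⟦ p ⟧ ≤ ⟦ q ⟧ * (⟦ r ⟧ * 1)
⟦⟧-× p q r P⇒ = ⟦⟧-≤ p λ x → *-mono-≤ {x = 1} {u = 1} (⟦⟧-true q (proj₁ (P⇒ x)))
  (*-mono-≤ {x = 1} {u = 1} (⟦⟧-true r (proj₂ (P⇒ x))) ≤-refl)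

module _ {N k : ℕ} {P : Pred (Map {N} {k}) 0ℓ} (P? : Decidable P) where

  #-bound : ∀ {I J : Set} (xs : List I) (ys : List J) {A : I → Set} {B : I → J → Set}
    {Q : I → J → Pred (Map {N} {k}) 0ℓ}
    (A? : ∀ i → Dec (A i)) (B? : ∀ i j → Dec (B i j)) (Q? : ∀ i j → Decidable (Q i j)) {L X Y M : ℕ} →
    (∀ φ → P φ → ∃[ i ] ∃[ j ] (i List.∈ xs × j List.∈ ys × Q i j φ)) →
    (∀ i j φ → Q i j φ → A i × B i j) →
    (∀ i j → A i → B i j → L * # (Q? i j) ≤ M) →
    ∑[ i ∈ xs ] ⟦ A? i ⟧ ≤ X → (∀ i → ∑[ j ∈ ys ] ⟦ B? i j ⟧ ≤ Y) → L * # P? ≤ X * (Y * M)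
  #-bound xs ys A? B? Q? {L} {X} {Y} {M} P⇒ Q⇒ bound ∑A ∑B = begin
    L * # P?                                            ≤⟨ *-monoʳ-≤ L (#-⋃ P? xs ys Q? P⇒) ⟩
    L * ∑[ i ∈ xs ] ∑[ j ∈ ys ] # (Q? i j)              ≡⟨ ∑-*ˡ xs L (λ i → ∑[ j ∈ ys ] # (Q? i j)) ⟨
    ∑[ i ∈ xs ] (L * ∑[ j ∈ ys ] # (Q? i j))            ≡⟨ ∑-cong xs (λ i → ∑-*ˡ ys L (λ j → # (Q? i j))) ⟨
    ∑[ i ∈ xs ] ∑[ j ∈ ys ] (L * # (Q? i j))
      ≤⟨ ∑∑-bound xs ys A? B? (λ i j → #-static (Q? i j) (A? i) (B? i j) {L} {M} (Q⇒ i j) (bound i j)) ∑A ∑B ⟩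
    X * (Y * M)                                         ∎
    where open ≤-Reasoning

∈-pairs : ∀ {a b} (i : Fin a) (j : Fin b) → (i , j) List.∈ cartesianProduct (allFin a) (allFin b)
∈-pairs i j = ∈-cartesianProduct⁺ (∈-allFin i) (∈-allFin j)

-- Numerical estimates

-- The inductive step of `fix-bound`: the three hypotheses are the gain from one switch, the
-- induction hypothesis, and the cost 64/49 of putting two points back.
fix-arithmetic : ∀ r {c l x y z w} → r * x ≤ y → c * y ≤ l * z → 49 * z ≤ 64 * w → (49 * r) * c * x ≤ 64 * l * w
fix-arithmetic r {c} {l} {x} {y} {z} {w} rx≤y cy≤lz 49z≤64w = begin
  (49 * r) * c * x   ≡⟨ left r c x ⟩
  49 * (c * (r * x)) ≤⟨ *-monoʳ-≤ 49 (*-monoʳ-≤ c rx≤y) ⟩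
  49 * (c * y)       ≤⟨ *-monoʳ-≤ 49 cy≤lz ⟩
  49 * (l * z)       ≡⟨ middle l z ⟩
  l * (49 * z)       ≤⟨ *-monoʳ-≤ l 49z≤64w ⟩
  l * (64 * w)       ≡⟨ right l w ⟩
  64 * l * w         ∎
  where
  open ≤-Reasoning
  left : ∀ r c x → (49 * r) * c * x ≡ 49 * (c * (r * x))
  left = solve-∀
  middle : ∀ l z → 49 * (l * z) ≡ l * (49 * z)
  middle = solve-∀
  right : ∀ l w → l * (64 * w) ≡ 64 * l * w
  right = solve-∀

-- Here `a` is `110 * Δ ^ 2` and `k` bounds a colour class. The summands stand for a second edge
-- that is disjoint from the first or shares one of its two ends; each is at most `k n Δ K`.
three-types : ∀ {a k n Δ K x y z} → a * k ≤ n → x ≤ k * ((n * Δ) * K) → y ≤ k * (Δ * (n * K)) → z ≤ k * (Δ * (n * K)) →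
              a * (x + (y + z)) ≤ 3 * (n * ((n * Δ) * K))
three-types {a} {k} {n} {Δ} {K} {x} {y} {z} ak≤n x≤ y≤ z≤ = begin
  a * (x + (y + z))                                                   ≤⟨ *-monoʳ-≤ a (+-mono-≤ x≤ (+-mono-≤ y≤ z≤)) ⟩
  a * (k * ((n * Δ) * K) + (k * (Δ * (n * K)) + k * (Δ * (n * K))))   ≡⟨ collect a k n Δ K ⟩
  3 * ((a * k) * ((n * Δ) * K))                                       ≤⟨ *-monoʳ-≤ 3 (*-monoˡ-≤ ((n * Δ) * K) ak≤n) ⟩
  3 * (n * ((n * Δ) * K))                                             ∎
  where
  open ≤-Reasoning
  collect : ∀ a k n Δ K → a * (k * ((n * Δ) * K) + (k * (Δ * (n * K)) + k * (Δ * (n * K)))) ≡ 3 * ((a * k) * ((n * Δ) * K))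
  collect = solve-∀

-- The ratio `s / t` is a lower bound for `r⁴ / n⁴`. Replacing `r⁴` accordingly lets `D` and `n⁴`
-- cancel, which leaves a comparison of constants.
cancel-scale : ∀ {D n⁴ r⁴ α β s t bad q} .{{_ : NonZero D}} .{{_ : NonZero n⁴}} .{{_ : NonZero (t * β)}} →
               (D * (α * r⁴)) * bad ≤ D * n⁴ * (β * q) → s * n⁴ ≤ t * r⁴ → 8 * (t * β) ≤ s * α → 8 * bad ≤ q
cancel-scale {D} {n⁴} {r⁴} {α} {β} {s} {t} {bad} {q} hyp sn≤tr const = *-cancelˡ-≤ (t * β) (begin
  (t * β) * (8 * bad) ≡⟨ e₁ (t * β) bad ⟩
  8 * (t * β) * bad   ≤⟨ *-monoˡ-≤ bad const ⟩
  s * α * bad         ≤⟨ *-cancelˡ-≤ n⁴ (*-cancelˡ-≤ D (begin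
    D * (n⁴ * (s * α * bad))   ≡⟨ e₂ D n⁴ s α bad ⟩
    D * α * bad * (s * n⁴)     ≤⟨ *-monoʳ-≤ (D * α * bad) sn≤tr ⟩
    D * α * bad * (t * r⁴)     ≡⟨ e₃ D α bad t r⁴ ⟩
    t * ((D * (α * r⁴)) * bad) ≤⟨ *-monoʳ-≤ t hyp ⟩
    t * (D * n⁴ * (β * q))     ≡⟨ e₄ t D n⁴ β q ⟩
    D * (n⁴ * ((t * β) * q))   ∎)) ⟩
  (t * β) * q         ∎)
  where
  open ≤-Reasoning
  e₁ : ∀ x y → x * (8 * y) ≡ 8 * x * y
  e₁ = solve-∀
  e₂ : ∀ D n⁴ s α bad → D * (n⁴ * (s * α * bad)) ≡ D * α * bad * (s * n⁴)
  e₂ = solve-∀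
  e₃ : ∀ D α bad t r⁴ → D * α * bad * (t * r⁴) ≡ t * ((D * (α * r⁴)) * bad)
  e₃ = solve-∀
  e₄ : ∀ t D n⁴ β q → t * (D * n⁴ * (β * q)) ≡ D * (n⁴ * ((t * β) * q))
  e₄ = solve-∀

[m*n]^4 : ∀ m n → (m * n) ^ 4 ≡ m ^ 4 * n ^ 4
[m*n]^4 = expanded
  where
  expanded : ∀ m n → m * n * (m * n * (m * n * (m * n * 1))) ≡ (m * (m * (m * (m * 1)))) * (n * (n * (n * (n * 1))))
  expanded = solve-∀

-- The choices on the right multiply to `3 Δ² n⁴`. Here `Δ²` cancels, and `n ^ 4` is compared with
-- `r ^ 4` by the fourth power of `9 * n ≤ 10 * r`.
bad-arithmetic : ∀ {n Δ r c β bad q} → c ≡ 49 * r → β ≡ 64 → 1 ≤ n → 1 ≤ Δ → 9 * n ≤ 10 * r →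
  (110 * Δ ^ 2 * c ^ 4) * bad ≤ n * ((Δ * n) * (3 * (n * ((n * Δ) * (β ^ 4 * q))))) → 8 * bad ≤ q
bad-arithmetic {n} {Δ} {r} {bad = bad} {q} refl refl 1≤n 1≤Δ 9n≤10r hyp =
  cancel-scale {Δ ^ 2} {n ^ 4} {r ^ 4} {110 * 49 ^ 4} {3 * 64 ^ 4} {9 ^ 4} {10 ^ 4}
    {{m^n≢0 Δ 2 {{>-nonZero 1≤Δ}}}} {{m^n≢0 n 4 {{>-nonZero 1≤n}}}}
    (≤-trans (≤-reflexive lhs) (≤-trans hyp (≤-reflexive (rhs n Δ (64 ^ 4) q))))
    (≤-trans (≤-reflexive (sym ([m*n]^4 9 n))) (≤-trans (^-monoˡ-≤ 4 9n≤10r) (≤-reflexive ([m*n]^4 10 r))))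
    -- The constant 110 is calibrated here: 3/110 times (64/49)^4 times (10/9)^4 is about 0.121,
    -- just below 1/8.
    (≤ᵇ⇒≤ (8 * (10 ^ 4 * (3 * 64 ^ 4))) (9 ^ 4 * (110 * 49 ^ 4)) _)
  where
  assoc : ∀ D c R b → (D * (110 * c * R)) * b ≡ 110 * D * (c * R) * b
  assoc = solve-∀
  lhs : (Δ ^ 2 * (110 * 49 ^ 4 * r ^ 4)) * bad ≡ (110 * Δ ^ 2 * (49 * r) ^ 4) * bad
  lhs = trans (assoc (Δ ^ 2) (49 ^ 4) (r ^ 4) bad) (cong (λ h → 110 * Δ ^ 2 * h * bad) (sym ([m*n]^4 49 r)))
  rhs : ∀ n Δ K q → n * ((Δ * n) * (3 * (n * ((n * Δ) * (K * q))))) ≡ (Δ * (Δ * 1)) * (n * (n * (n * (n * 1)))) * (3 * K * q)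
  rhs = solve-∀

-- Opaque, since 64 ^ 4 * q must never be unfolded into a sum of 64 ^ 4 terms.
opaque
  β : ℕ
  β = 64

  β≡64 : β ≡ 64
  β≡64 = refl

-- Counting the placings lost when a point is put back

module LocalLemma (G : Graph) {N m : ℕ} (class : Vertex G → Fin m) (classᴴ : Fin N → Fin m)
  (col : Fin N → Fin N → ℕ) (col-sym : ∀ b b′ → col b b′ ≡ col b′ b)
  (n Δ : ℕ) (k : ℕ → ℕ) (30≤n : 30 ≤ n) (1≤Δ : 1 ≤ Δ)
  (class-size : ∀ i → ∑[ z ∈ allFin N ] ⟦ i ≟ classᴴ z ⟧ ≡ n)
  (part-size : ∀ i → ∑[ v ∈ allFin (Graph.order G) ] ⟦ i ≟ class v ⟧ ≤ n)
  (degree≤Δ : ∀ v → ∑[ u ∈ allFin (Graph.order G) ] ⟦ Graph.adj? G v u ⟧ ≤ Δ)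
  (class-adj : ∀ {v u} → Graph.Adj G v u → class v ≢ class u)
  (colour-size : ∀ i → ∑[ d ∈ allFin N ] ∑[ d′ ∈ allFin N ]
    ⟦ (d <? d′) ×-dec ¬? (classᴴ d ≟ classᴴ d′) ×-dec (col d d′ ℕ.≟ i) ⟧ ≤ k i)
  (star-size : ∀ i d → ∑[ d′ ∈ allFin N ] ⟦ ¬? (classᴴ d ≟ classᴴ d′) ×-dec (col d d′ ℕ.≟ i) ⟧ ≤ k i)
  (bounded : ∀ i → 110 * Δ ^ 2 * k i ≤ n)
  where
  open Graph G using (order; Adj; adj?; adj-sym; adj-irrefl)
  open Placement G class classᴴ col col-sym

  r : ℕ
  r = n ∸ 3

  opaque
    -- Fixing a ↦ b removes the two points a and b, which costs (8/7)² = 64/49, and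
    -- leaves at least n ∸ 3 vertices available as other images of a.
    c : ℕ
    c = 49 * r

    c≡49r : c ≡ 49 * r
    c≡49r = refl

  -- Pays for a missing factor `c` when only three vertices, instead of four, have prescribed
  -- images.
  c≤βn : c ≤ β * n
  c≤βn = subst₂ (λ x y → x ≤ y * n) (sym c≡49r) (sym β≡64) (*-mono-≤ {x = 49} {y = 64} (≤ᵇ⇒≤ 49 64 _) (m∸n≤m n 3))

  -- Since `10 * r` is 10 n - 30, this is exactly the condition `30 ≤ n`.
  9n≤10r : 9 * n ≤ 10 * r
  9n≤10r = subst (9 * n ≤_) (sym (*-distribˡ-∸ 10 n 3)) (m+n≤o⇒m≤o∸n (9 * n)
    (≤-trans (+-monoʳ-≤ (9 * n) 30≤n) (≤-reflexive (+-comm (9 * n) n))))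

  neighbours-size : ∀ v → ∑[ j ∈ cartesianProduct (allFin order) (allFin N) ]
    ⟦ adj? v (proj₁ j) ×-dec (class (proj₁ j) ≟ classᴴ (proj₂ j)) ⟧ ≤ Δ * n
  neighbours-size v = begin
    _ ≡⟨ ∑-cartesianProductWith _,_ (allFin order) (allFin N) _ ⟩
    _ ≤⟨ ∑∑-bound (allFin order) (allFin N) (adj? v) (λ u b → class u ≟ classᴴ b) {M = 1}
           (λ u b → ⟦⟧-× (adj? v u ×-dec (class u ≟ classᴴ b)) (adj? v u) (class u ≟ classᴴ b) (λ x → x))
           (degree≤Δ v) (λ u → ≤-reflexive (class-size (class u))) ⟩
    Δ * (n * 1) ≡⟨ cong (Δ *_) (*-identityʳ n) ⟩
    Δ * n ∎
    where open ≤-Reasoning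

  -- There are at most `n` vertices in the part and at most `Δ` neighbours of each. It counts the
  -- edges of `G` that can be mapped onto a given host edge whose first end has class `i`.
  edges-size : ∀ i → ∑[ j ∈ cartesianProduct (allFin order) (allFin order) ]
    ⟦ (i ≟ class (proj₁ j)) ×-dec adj? (proj₁ j) (proj₂ j) ⟧ ≤ n * Δ
  edges-size i = begin
    _ ≡⟨ ∑-cartesianProductWith _,_ (allFin order) (allFin order) _ ⟩
    _ ≤⟨ ∑∑-bound (allFin order) (allFin order) (λ x → i ≟ class x) adj? {M = 1}
           (λ x y → ⟦⟧-× ((i ≟ class x) ×-dec adj? x y) (i ≟ class x) (adj? x y) (λ x → x))
           (part-size i) degree≤Δ ⟩
    n * (Δ * 1) ≡⟨ cong (n *_) (*-identityʳ Δ) ⟩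
    n * Δ ∎
    where open ≤-Reasoning

  colour-size′ : ∀ i → ∑[ e ∈ cartesianProduct (allFin N) (allFin N) ]
    ⟦ (proj₁ e <? proj₂ e) ×-dec ¬? (classᴴ (proj₁ e) ≟ classᴴ (proj₂ e)) ×-dec (col (proj₁ e) (proj₂ e) ℕ.≟ i) ⟧ ≤ k i
  colour-size′ i = ≤-trans (≤-reflexive (∑-cartesianProductWith _,_ (allFin N) (allFin N) _)) (colour-size i)

  Touches : Point → Vertex G → Fin N → Set
  Touches p v b = p ≡ v ↑ˡ N ⊎ p ≡ order ↑ʳ b

  touches? : ∀ p v b → Dec (Touches p v b)
  touches? p v b = (p ≟ v ↑ˡ N) ⊎-dec (p ≟ order ↑ʳ b)

  -- If `p` is a vertex of `G`, then `v` is determined and `b` ranges over a class; if `p` is a host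
  -- vertex, then `b` is determined and `v` ranges over a part.
  touches-size : ∀ p → ∑[ i ∈ cartesianProduct (allFin order) (allFin N) ]
    ⟦ touches? p (proj₁ i) (proj₂ i) ×-dec (class (proj₁ i) ≟ classᴴ (proj₂ i)) ⟧ ≤ n
  touches-size p = ≤-trans (≤-reflexive (∑-cartesianProductWith _,_ (allFin order) (allFin N) _)) (split (splitAt order p) refl)
    where
    open ≤-Reasoning
    F : Vertex G → Fin N → ℕ
    F v b = ⟦ touches? p v b ×-dec (class v ≟ classᴴ b) ⟧
    split : ∀ s → splitAt order p ≡ s → ∑[ v ∈ allFin order ] ∑[ b ∈ allFin N ] F v b ≤ n
    split (inj₁ v₀) eq = begin
      _ ≤⟨ ∑∑-bound (allFin order) (allFin N) (λ v → v₀ ≟ v) (λ v b → class v ≟ classᴴ b) {M = 1}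
             (λ v b → ⟦⟧-× (touches? p v b ×-dec (class v ≟ classᴴ b)) (v₀ ≟ v) (class v ≟ classᴴ b)
                (λ (t , e) → only t , e))
             (≤-reflexive (∑-≟ v₀)) (λ v → ≤-reflexive (class-size (class v))) ⟩
      1 * (n * 1) ≡⟨ trans (*-identityˡ _) (*-identityʳ n) ⟩
      n ∎
      where
      only : ∀ {v b} → Touches p v b → v₀ ≡ v
      only {v} (inj₁ refl) = inj₁-injective (trans (sym eq) (splitAt-↑ˡ order v N))
      only {b = b} (inj₂ refl) = contradiction (trans (sym eq) (splitAt-↑ʳ order N b)) λ ()
    split (inj₂ b₀) eq = begin
      _ ≡⟨ ∑-comm (allFin order) (allFin N) F ⟩
      _ ≤⟨ ∑∑-bound (allFin N) (allFin order) (λ b → b₀ ≟ b) (λ b v → classᴴ b ≟ class v) {M = 1}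
             (λ b v → ⟦⟧-× (touches? p v b ×-dec (class v ≟ classᴴ b)) (b₀ ≟ b) (classᴴ b ≟ class v)
                (λ (t , e) → only t , sym e))
             (≤-reflexive (∑-≟ b₀)) (λ b → part-size (classᴴ b)) ⟩
      1 * (n * 1) ≡⟨ trans (*-identityˡ _) (*-identityʳ n) ⟩
      n ∎
      where
      only : ∀ {v b} → Touches p v b → b₀ ≡ b
      only {v} (inj₁ refl) = contradiction (trans (sym eq) (splitAt-↑ˡ order v N)) λ ()
      only {b = b} (inj₂ refl) = inj₂-injective (trans (sym eq) (splitAt-↑ʳ order N b))

  -- The parameter `decay` is the induction hypothesis, for sets of fewer than `s` points.
  module _ (s : ℕ) (decay : ∀ T p → ∣ T ∣ < s → 7 * # (ok? (T - p)) ≤ 8 * # (ok? T)) where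

    decay₂ : ∀ T p q → ∣ T ∣ < s → 49 * # (ok? (T - p - q)) ≤ 64 * # (ok? T)
    decay₂ T p q T<s = begin
      49 * # (ok? (T - p - q))      ≡⟨ *-assoc 7 7 (# (ok? (T - p - q))) ⟩
      7 * (7 * # (ok? (T - p - q))) ≤⟨ *-monoʳ-≤ 7 (decay (T - p) q (≤-<-trans (∣p─q∣≤∣p∣ T ⁅ p ⁆) T<s)) ⟩
      7 * (8 * # (ok? (T - p)))     ≡⟨ trans (sym (*-assoc 7 8 (# (ok? (T - p))))) (*-assoc 8 7 (# (ok? (T - p)))) ⟩
      8 * (7 * # (ok? (T - p)))     ≤⟨ *-monoʳ-≤ 8 (decay T p T<s) ⟩
      8 * (8 * # (ok? T))           ≡⟨ *-assoc 8 8 (# (ok? T)) ⟨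
      64 * # (ok? T)                ∎
      where open ≤-Reasoning

    -- By induction on the list: `switch` trades the first pair for a factor of at least `r` and the
    -- removal of `a` and `b`; the remaining pairs are handled in `T′`; `decay₂` returns to `T`.
    -- With at most four pairs, at most three images are forbidden in any switch, hence `n ∸ 3`.
    fix-bound : ∀ As T → AllPairs (λ p q → proj₁ q ≢ proj₁ p) As → length As ≤ 4 → ∣ T ∣ < s →
                c ^ length As * # (ok? T ∩? fix? As) ≤ β ^ length As * # (ok? T)
    fix-bound [] T _ _ _ = *-monoʳ-≤ 1 (#-mono (ok? T ∩? fix? []) (ok? T) λ _ → proj₁)
    fix-bound ((a , b) ∷ As) T (a∉As ∷ distinct) (s≤s len) T<s =
      subst₂ (λ x y → x * c ^ length As * X ≤ y * β ^ length As * W) (sym c≡49r) (sym β≡64)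
        (fix-arithmetic r {c ^ length As} {β ^ length As} {X} {Y} {Z} {W}
          (≤-trans (*-monoˡ-≤ X (∸-monoʳ-≤ n len)) (switch class-size T a b As a∉As))
          (fix-bound As T′ distinct (m≤n⇒m≤1+n len) T′<s)
          (decay₂ T (a ↑ˡ N) (order ↑ʳ b) T<s))
      where
      T′ = T - (a ↑ˡ N) - (order ↑ʳ b)
      X = # (ok? T ∩? fix? ((a , b) ∷ As))
      Y = # (ok? T′ ∩? fix? As)
      Z = # (ok? T′)
      W = # (ok? T)
      T′<s : ∣ T′ ∣ < s
      T′<s = ≤-<-trans (∣p─q∣≤∣p∣ (T - (a ↑ˡ N)) ⁅ order ↑ʳ b ⁆) (≤-<-trans (∣p─q∣≤∣p∣ T ⁅ a ↑ˡ N ⁆) T<s)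

    module Pair (T : Subset (order + N)) (T<s : ∣ T ∣ < s) (v u : Vertex G) (b b′ : Fin N) (v~u : Adj v u) where
      i : ℕ
      i = col b b′

      q : ℕ
      q = # (ok? T)

      ends : List (Vertex G × Fin N)
      ends = (v , b) ∷ (u , b′) ∷ []

      Clashing : Pred Placing 0ℓ
      Clashing = (Ok T ∩ Fix ends) ∩ λ φ → ∃[ x ] ∃[ y ] Clash φ v u x y

      clashing? : Decidable Clashing
      clashing? = (ok? T ∩? fix? ends) ∩? λ φ → any? λ x → any? λ y → clash? φ v u x y

      u≢v : u ≢ v
      u≢v u≡v = adj-irrefl (sym u≡v) v~u

      -- Ordering `x` and `y` by their images selects one orientation of the second edge, in
      -- accordance with `colour-size`, where each host edge is counted once.
      Disjoint : Pred Placing 0ℓ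
      Disjoint = Clashing ∩ λ φ → ∃[ x ] ∃[ y ] (x ≢ v × x ≢ u × y ≢ v × y ≢ u × lookup φ x Fin.< lookup φ y × Clash φ v u x y)

      disjoint? : Decidable Disjoint
      disjoint? = clashing? ∩? λ φ → any? λ x → any? λ y →
        ¬? (x ≟ v) ×-dec ¬? (x ≟ u) ×-dec ¬? (y ≟ v) ×-dec ¬? (y ≟ u) ×-dec (lookup φ x <? lookup φ y) ×-dec clash? φ v u x y

      -- The second edge is `w y`, where `w` is the end shared with the first edge and `d` is its
      -- image.
      Adjacent : Vertex G → Fin N → Pred Placing 0ℓ
      Adjacent w d = (Ok T ∩ Fix ends) ∩ λ φ → ∃[ y ] (y ≢ v × y ≢ u × Adj w y × lookup φ w ≡ d × i ≡ col d (lookup φ y))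

      adjacent? : ∀ w d → Decidable (Adjacent w d)
      adjacent? w d = (ok? T ∩? fix? ends) ∩? λ φ → any? λ y →
        ¬? (y ≟ v) ×-dec ¬? (y ≟ u) ×-dec adj? w y ×-dec (lookup φ w ≟ d) ×-dec (i ℕ.≟ col d (lookup φ y))

      valid-adj : ∀ {φ x y} → Valid φ → Adj x y → classᴴ (lookup φ x) ≢ classᴴ (lookup φ y)
      valid-adj valid x~y eq = class-adj x~y (trans (sym (proj₂ valid _)) (trans eq (proj₂ valid _)))

      -- Choose the image of the second edge among the `k i` host edges of colour `i`, then the edge
      -- itself with `x` in the class of `d`. All four ends now have prescribed images, so
      -- `fix-bound` applies.
      disjoint-bound : c ^ 4 * # disjoint? ≤ k i * ((n * Δ) * (β ^ 4 * q))
      disjoint-bound = #-bound disjoint? (cartesianProduct (allFin N) (allFin N)) (cartesianProduct (allFin order) (allFin order))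
        A? (λ e → B? e) Q? {c ^ 4} {M = β ^ 4 * q} cover (λ _ _ φ → proj₂) bound (colour-size′ i) (λ (d , _) → edges-size (classᴴ d))
        where
        A? : (e : Fin N × Fin N) → Dec (proj₁ e Fin.< proj₂ e × classᴴ (proj₁ e) ≢ classᴴ (proj₂ e) × col (proj₁ e) (proj₂ e) ≡ i)
        A? (d , d′) = (d <? d′) ×-dec ¬? (classᴴ d ≟ classᴴ d′) ×-dec (col d d′ ℕ.≟ i)
        B? : ∀ e (f : Vertex G × Vertex G) → Dec (classᴴ (proj₁ e) ≡ class (proj₁ f) × Adj (proj₁ f) (proj₂ f))
        B? (d , _) (x , y) = (classᴴ d ≟ class x) ×-dec adj? x y
        all : Fin N × Fin N → Vertex G × Vertex G → List (Vertex G × Fin N)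
        all (d , d′) (x , y) = (x , d) ∷ (y , d′) ∷ ends
        Apart? : (f : Vertex G × Vertex G) → Dec (proj₁ f ≢ v × proj₁ f ≢ u × proj₂ f ≢ v × proj₂ f ≢ u)
        Apart? (x , y) = ¬? (x ≟ v) ×-dec ¬? (x ≟ u) ×-dec ¬? (y ≟ v) ×-dec ¬? (y ≟ u)
        Q? = λ e f → ((ok? T ∩? fix? (all e f)) ∩? λ _ → Apart? f) ∩? λ _ → A? e ×-dec B? e f
        cover : ∀ φ → Disjoint φ → _
        cover φ (((ok valid free , fixed@(refl ∷ refl ∷ [])) , _) , x , y , x≢v , x≢u , y≢v , y≢u , lt , _ , x~y , _ , _ , eq) =
          (lookup φ x , lookup φ y) , (x , y) , ∈-pairs _ _ , ∈-pairs _ _ ,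
          ((ok valid free , (refl ∷ refl ∷ fixed)) , (x≢v , x≢u , y≢v , y≢u)) ,
          (lt , valid-adj {φ} valid x~y , sym eq) , (proj₂ valid x , x~y)
        bound : ∀ e f → _ → _ → c ^ 4 * # (Q? e f) ≤ β ^ 4 * q
        bound e f@(x , y) _ (_ , x~y) = by (Apart? f)
          where
          by : _ → c ^ 4 * # (Q? e f) ≤ β ^ 4 * q
          by (no ¬apart) = ≤-trans (≤-reflexive (trans
            (cong (c ^ 4 *_) (#-empty (Q? e f) λ φ ((_ , apart) , _) → ¬apart apart)) (*-zeroʳ (c ^ 4)))) z≤n
          by (yes (x≢v , x≢u , y≢v , y≢u)) = ≤-trans
            (*-monoʳ-≤ (c ^ 4) (#-mono (Q? e f) (ok? T ∩? fix? (all e f)) λ _ → proj₁ ∘ proj₁))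
            (fix-bound (all e f) T
              (((λ y≡x → adj-irrefl (sym y≡x) x~y) ∷ (x≢v ∘ sym) ∷ (x≢u ∘ sym) ∷ []) ∷
               ((y≢v ∘ sym) ∷ (y≢u ∘ sym) ∷ []) ∷ (u≢v ∷ []) ∷ [] ∷ [])
              ≤-refl T<s)

      -- The image of `y` is one of at most `k i` vertices joined to `d` in colour `i`, and `y` is
      -- one of at most `Δ` neighbours of `w`.
      adjacent-bound : ∀ w d → c ^ 4 * # (adjacent? w d) ≤ k i * (Δ * (n * (β ^ 4 * q)))
      adjacent-bound w d = #-bound (adjacent? w d) (allFin N) (allFin order) A? (λ _ → adj? w) Q? {c ^ 4} {M = n * (β ^ 4 * q)}
        cover (λ _ _ φ → proj₂) bound (star-size i d) (λ _ → degree≤Δ w)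
        where
        A? : ∀ d′ → Dec (classᴴ d ≢ classᴴ d′ × col d d′ ≡ i)
        A? d′ = ¬? (classᴴ d ≟ classᴴ d′) ×-dec (col d d′ ℕ.≟ i)
        Apart? : ∀ y → Dec (y ≢ v × y ≢ u)
        Apart? y = ¬? (y ≟ v) ×-dec ¬? (y ≟ u)
        Q? = λ d′ y → ((ok? T ∩? fix? ((y , d′) ∷ ends)) ∩? λ _ → Apart? y) ∩? λ _ → A? d′ ×-dec adj? w y
        cover : ∀ φ → Adjacent w d φ → _
        cover φ ((ok valid free , fixed) , y , y≢v , y≢u , w~y , refl , eq) =
          lookup φ y , y , ∈-allFin _ , ∈-allFin _ ,
          ((ok valid free , (refl ∷ fixed)) , (y≢v , y≢u)) , (valid-adj {φ} valid w~y , sym eq) , w~y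
        bound : ∀ d′ y → _ → _ → c ^ 4 * # (Q? d′ y) ≤ n * (β ^ 4 * q)
        bound d′ y _ _ = by (Apart? y)
          where
          open ≤-Reasoning
          rearrange : ∀ B n K q → B * n * (K * q) ≡ n * (B * K * q)
          rearrange = solve-∀
          by : _ → c ^ 4 * # (Q? d′ y) ≤ n * (β ^ 4 * q)
          by (no ¬apart) = ≤-trans (≤-reflexive (trans
            (cong (c ^ 4 *_) (#-empty (Q? d′ y) λ φ ((_ , apart) , _) → ¬apart apart)) (*-zeroʳ (c ^ 4)))) z≤n
          by (yes (y≢v , y≢u)) = begin
            -- Three prescribed images give only `c ^ 3`; the fourth factor costs `β * n`, which
            -- brings the total to the same order as for disjoint edges.
            c ^ 4 * # (Q? d′ y)       ≡⟨ *-assoc c (c ^ 3) (# (Q? d′ y)) ⟩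
            c * (c ^ 3 * # (Q? d′ y)) ≤⟨ *-mono-≤ c≤βn (≤-trans
              (*-monoʳ-≤ (c ^ 3) (#-mono (Q? d′ y) (ok? T ∩? fix? ((y , d′) ∷ ends)) λ _ → proj₁ ∘ proj₁))
              (fix-bound ((y , d′) ∷ ends) T (((y≢v ∘ sym) ∷ (y≢u ∘ sym) ∷ []) ∷ (u≢v ∷ []) ∷ [] ∷ []) (n≤1+n 3) T<s)) ⟩
            β * n * (β ^ 3 * q)       ≡⟨ rearrange β n (β ^ 3) q ⟩
            n * (β * β ^ 3 * q)       ∎

      -- If the second edge meets the first, its other end is neither `v` nor `u`, because the edges
      -- differ and `G` has no loops.
      classify : ∀ φ → Clashing φ → Disjoint φ ⊎ (Adjacent v b φ ⊎ Adjacent u b′ φ)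
      classify φ cl@((ok valid free , fixed@(refl ∷ refl ∷ [])) , x , y , clash@(_ , x~y , ≢₁ , ≢₂ , eq)) =
        go (x ≟ v) (x ≟ u) (y ≟ v) (y ≟ u) (<-cmp (lookup φ x) (lookup φ y))
        where
        ok-fixed = ok valid free , fixed
        eq′ = trans eq (col-sym (lookup φ x) (lookup φ y))
        y≢x : y ≢ x
        y≢x y≡x = adj-irrefl (sym y≡x) x~y
        at : ∀ {w z} → w ≡ z → lookup φ w ≡ lookup φ z
        at = cong (lookup φ)
        go : Dec (x ≡ v) → Dec (x ≡ u) → Dec (y ≡ v) → Dec (y ≡ u) →
             Tri (lookup φ x Fin.< lookup φ y) (lookup φ x ≡ lookup φ y) (lookup φ y Fin.< lookup φ x) →
             Disjoint φ ⊎ (Adjacent v (lookup φ v) φ ⊎ Adjacent u (lookup φ u) φ)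
        go (yes x≡v) _ _ _ _ = inj₂ (inj₁ (ok-fixed , y , (λ y≡v → y≢x (trans y≡v (sym x≡v))) , (λ y≡u → ≢₁ (sym x≡v , sym y≡u)) ,
          subst (λ w → Adj w y) x≡v x~y , refl , trans eq (cong (λ d → col d (lookup φ y)) (at x≡v))))
        go _ (yes x≡u) _ _ _ = inj₂ (inj₂ (ok-fixed , y , (λ y≡v → ≢₂ (sym y≡v , sym x≡u)) , (λ y≡u → y≢x (trans y≡u (sym x≡u))) ,
          subst (λ w → Adj w y) x≡u x~y , refl , trans eq (cong (λ d → col d (lookup φ y)) (at x≡u))))
        go _ _ (yes y≡v) _ _ = inj₂ (inj₁ (ok-fixed , x , (λ x≡v → y≢x (trans y≡v (sym x≡v))) , (λ x≡u → ≢₂ (sym y≡v , sym x≡u)) ,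
          subst (λ w → Adj w x) y≡v (adj-sym x~y) , refl , trans eq′ (cong (λ d → col d (lookup φ x)) (at y≡v))))
        go _ _ _ (yes y≡u) _ = inj₂ (inj₂ (ok-fixed , x , (λ x≡v → ≢₁ (sym x≡v , sym y≡u)) , (λ x≡u → y≢x (trans y≡u (sym x≡u))) ,
          subst (λ w → Adj w x) y≡u (adj-sym x~y) , refl , trans eq′ (cong (λ d → col d (lookup φ x)) (at y≡u))))
        go (no x≢v) (no x≢u) (no y≢v) (no y≢u) (tri< lt _ _) = inj₁ (cl , x , y , x≢v , x≢u , y≢v , y≢u , lt , clash)
        go (no x≢v) (no x≢u) (no y≢v) (no y≢u) (tri≈ _ φx≡φy _) = contradiction (sym (proj₁ valid x y φx≡φy)) y≢x
        -- A flip between two swaps reverses the second edge.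
        go (no x≢v) (no x≢u) (no y≢v) (no y≢u) (tri> _ _ gt) = inj₁ (cl , y , x , y≢v , y≢u , x≢v , x≢u , gt ,
          clash-swap {φ} (clash-flip {φ} (clash-swap {φ} clash)))

      clashing-bound : (110 * Δ ^ 2 * c ^ 4) * # clashing? ≤ 3 * (n * ((n * Δ) * (β ^ 4 * q)))
      clashing-bound = begin
        (110 * Δ ^ 2 * c ^ 4) * # clashing?   ≡⟨ *-assoc (110 * Δ ^ 2) (c ^ 4) (# clashing?) ⟩
        110 * Δ ^ 2 * (c ^ 4 * # clashing?)   ≤⟨ *-monoʳ-≤ (110 * Δ ^ 2) split ⟩
        110 * Δ ^ 2 * (c ^ 4 * # disjoint? + (c ^ 4 * # (adjacent? v b) + c ^ 4 * # (adjacent? u b′)))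
          ≤⟨ three-types {110 * Δ ^ 2} {k i} {n} {Δ} {β ^ 4 * q} (bounded i) disjoint-bound (adjacent-bound v b) (adjacent-bound u b′) ⟩
        3 * (n * ((n * Δ) * (β ^ 4 * q)))    ∎
        where
        open ≤-Reasoning
        distrib : ∀ a x y z → a * (x + (y + z)) ≡ a * x + (a * y + a * z)
        distrib = solve-∀
        split : c ^ 4 * # clashing? ≤ c ^ 4 * # disjoint? + (c ^ 4 * # (adjacent? v b) + c ^ 4 * # (adjacent? u b′))
        split = begin
          c ^ 4 * # clashing?
            ≤⟨ *-monoʳ-≤ (c ^ 4) (≤-trans (#-∪ clashing? disjoint? (adjacent? v b ∪? adjacent? u b′) classify)
                 (+-monoʳ-≤ (# disjoint?) (#-∪ (adjacent? v b ∪? adjacent? u b′) (adjacent? v b) (adjacent? u b′) λ _ x → x))) ⟩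
          c ^ 4 * (# disjoint? + (# (adjacent? v b) + # (adjacent? u b′)))
            ≡⟨ distrib (c ^ 4) (# disjoint?) (# (adjacent? v b)) (# (adjacent? u b′)) ⟩
          c ^ 4 * # disjoint? + (c ^ 4 * # (adjacent? v b) + c ^ 4 * # (adjacent? u b′)) ∎

    module Removal (S : Subset (order + N)) (p : Point) (T<s : ∣ S - p ∣ < s) where
      T : Subset (order + N)
      T = S - p

      Conflicting : Placing → Set
      Conflicting φ = ∃[ v ] ∃[ u ] ∃[ x ] ∃[ y ] Conflict S φ v u x y

      conflicting? : ∀ φ → Dec (Conflicting φ)
      conflicting? φ = any? λ v → any? λ u → any? λ x → any? λ y → conflict? S φ v u x y

      bad? : Decidable (Ok T ∩ Conflicting)
      bad? = ok? T ∩? conflicting?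

      -- A conflict in `S` that is absent from `T` has an end for which `p` is the vertex or its
      -- image. The symmetries of `Clash` bring this end to the front.
      touching : ∀ φ → (Ok T ∩ Conflicting) φ → ∃[ v ] ∃[ u ] ∃[ x ] ∃[ y ] (Clash φ v u x y × Touches p v (lookup φ v))
      touching φ (ok _ free , v , u , x , y , clash , v∈ , u∈ , x∈ , y∈) =
        go (touches? p v (lookup φ v)) (touches? p u (lookup φ u)) (touches? p x (lookup φ x)) (touches? p y (lookup φ y))
        where
        stays : ∀ {w} → Inside S φ w → ¬ Touches p w (lookup φ w) → Inside T φ w
        stays (w∈ , φw∈) ¬t =
          x∈p∧x≢y⇒x∈p-y w∈ (λ eq → ¬t (inj₁ (sym eq))) , x∈p∧x≢y⇒x∈p-y φw∈ (λ eq → ¬t (inj₂ (sym eq)))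
        go : Dec (Touches p v (lookup φ v)) → Dec (Touches p u (lookup φ u)) →
             Dec (Touches p x (lookup φ x)) → Dec (Touches p y (lookup φ y)) →
             ∃[ v ] ∃[ u ] ∃[ x ] ∃[ y ] (Clash φ v u x y × Touches p v (lookup φ v))
        go (yes t) _ _ _ = v , u , x , y , clash , t
        go _ (yes t) _ _ = u , v , x , y , clash-flip {φ} clash , t
        go _ _ (yes t) _ = x , y , v , u , clash-swap {φ} clash , t
        go _ _ _ (yes t) = y , x , v , u , clash-flip {φ} (clash-swap {φ} clash) , t
        go (no ¬v) (no ¬u) (no ¬x) (no ¬y) =
          contradiction (clash , stays v∈ ¬v , stays u∈ ¬u , stays x∈ ¬x , stays y∈ ¬y) (free v u x y)

      -- There are at most `n` choices of an end `v` touching `p` together with its image, at most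
      -- `Δ * n` of a neighbour `u` with its image, and then `clashing-bound` applies.
      bad-bound : (110 * Δ ^ 2 * c ^ 4) * # bad? ≤ n * ((Δ * n) * (3 * (n * ((n * Δ) * (β ^ 4 * # (ok? T))))))
      bad-bound = #-bound bad? (cartesianProduct (allFin order) (allFin N)) (cartesianProduct (allFin order) (allFin N))
        A? (λ e → B? e) Q? {110 * Δ ^ 2 * c ^ 4} {M = 3 * (n * ((n * Δ) * (β ^ 4 * # (ok? T))))}
        cover (λ _ _ φ → proj₂) bound (touches-size p) (λ (v , _) → neighbours-size v)
        where
        A? : (e : Vertex G × Fin N) → Dec (Touches p (proj₁ e) (proj₂ e) × class (proj₁ e) ≡ classᴴ (proj₂ e))
        A? (v , b) = touches? p v b ×-dec (class v ≟ classᴴ b)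
        B? : ∀ e (f : Vertex G × Fin N) → Dec (Adj (proj₁ e) (proj₁ f) × class (proj₁ f) ≡ classᴴ (proj₂ f))
        B? (v , _) (u , b′) = adj? v u ×-dec (class u ≟ classᴴ b′)
        Q? = λ e f → ((ok? T ∩? fix? (e ∷ f ∷ [])) ∩?
          λ φ → any? λ x → any? λ y → clash? φ (proj₁ e) (proj₁ f) x y) ∩? λ _ → A? e ×-dec B? e f
        cover : ∀ φ → (Ok T ∩ Conflicting) φ → _
        cover φ bad@(ok valid free , _) with v , u , x , y , clash , t ← touching φ bad =
          (v , lookup φ v) , (u , lookup φ u) , ∈-pairs _ _ , ∈-pairs _ _ ,
          ((ok valid free , (refl ∷ refl ∷ [])) , x , y , clash) , (t , sym (proj₂ valid v)) , (proj₁ clash , sym (proj₂ valid u))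
        bound : ∀ e f → _ → _ → (110 * Δ ^ 2 * c ^ 4) * # (Q? e f) ≤ 3 * (n * ((n * Δ) * (β ^ 4 * # (ok? T))))
        bound e@(v , b) f@(u , b′) _ (v~u , _) = ≤-trans
          (*-monoʳ-≤ (110 * Δ ^ 2 * c ^ 4) (#-mono (Q? e f) (Pair.clashing? T T<s v u b b′ v~u) λ _ → proj₁))
          (Pair.clashing-bound T T<s v u b b′ v~u)

      -- At most one eighth of the placings ok for `T` are bad, and all others remain ok for `S`.
      removal : 7 * # (ok? T) ≤ 8 * # (ok? S)
      removal = weaken {# (ok? S)} {# bad?} (#-∪ (ok? T) (ok? S) bad? restore)
        (bad-arithmetic {n} {Δ} {r} {c} {β} {# bad?} {# (ok? T)} c≡49r β≡64 (≤-trans (s≤s z≤n) 30≤n) 1≤Δ 9n≤10r bad-bound)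
        where
        restore : ∀ φ → Ok T φ → Ok S φ ⊎ (Ok T ∩ Conflicting) φ
        restore φ okT@(ok valid _) with conflicting? φ
        ... | yes conflict = inj₂ (okT , conflict)
        ... | no ¬conflict = inj₁ (ok valid λ v u x y conflict → ¬conflict (v , u , x , y , conflict))
        weaken : ∀ {w x y} → y ≤ w + x → 8 * x ≤ y → 7 * y ≤ 8 * w
        weaken {w} {x} {y} y≤ 8x≤y = +-cancelʳ-≤ y (7 * y) (8 * w) (begin
          7 * y + y         ≡⟨ +-comm (7 * y) y ⟩
          8 * y             ≤⟨ *-monoʳ-≤ 8 y≤ ⟩
          8 * (w + x)       ≡⟨ *-distribˡ-+ 8 w x ⟩
          8 * w + 8 * x     ≤⟨ +-monoʳ-≤ (8 * w) 8x≤y ⟩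
          8 * w + y         ∎)
          where open ≤-Reasoning

  -- By induction on a strict bound for the size of `S`. For `p ∈ S` the set `S - p` is smaller, so
  -- the hypothesis serves in `Removal`; otherwise `S ⊆ S - p` and no placing is lost.
  decay : ∀ s S p → ∣ S ∣ < s → 7 * # (ok? (S - p)) ≤ 8 * # (ok? S)
  decay (suc s) S p (s≤s S≤s) with p ∈? S
  ... | yes p∈S = Removal.removal s (decay s) S p (<-≤-trans (x∈p⇒∣p-x∣<∣p∣ p∈S) S≤s)
  ... | no  p∉S = *-mono-≤ (n≤1+n 7) (#-mono (ok? (S - p)) (ok? S) λ φ (ok valid free) →
    ok valid (free-antitone (λ {x} x∈S → x∈p∧x≢y⇒x∈p-y x∈S λ { refl → p∉S x∈S }) φ free))

  -- The empty set has no conflicts, and by `decay` a positive count cannot drop to 0 when a point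
  -- is put back.
  ok-exists : 1 ≤ # valid? → ∀ S → 1 ≤ # (ok? S)
  ok-exists 1≤valid S = go (suc ∣ S ∣) S ≤-refl
    where
    go : ∀ s S → ∣ S ∣ < s → 1 ≤ # (ok? S)
    go (suc s) S (s≤s S≤s) with nonempty? S
    ... | no empty = ≤-trans 1≤valid (#-mono valid? (ok? S) λ φ valid →
      ok valid λ { v u x y (_ , (v∈ , _) , _) → empty (_ , v∈) })
    ... | yes (p , p∈S) with # (ok? S) | go s (S - p) (<-≤-trans (x∈p⇒∣p-x∣<∣p∣ p∈S) S≤s) | decay (suc s) S p (s≤s S≤s)
    ...   | suc _ | _    | _  = s≤s z≤n
    ...   | zero  | 1≤   | 7≤ = contradiction (≤-trans (*-monoʳ-≤ 7 1≤) 7≤) λ ()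

  rainbow-placing : 1 ≤ # valid? → ∃[ φ ] (Valid φ × (∀ v u x y → ¬ Clash φ v u x y))
  rainbow-placing 1≤valid = let φ , ok valid free = #-positive (ok? ⊤) (ok-exists 1≤valid ⊤) in
    φ , valid , λ v u x y clash → free v u x y (clash , (∈⊤ , ∈⊤) , (∈⊤ , ∈⊤) , (∈⊤ , ∈⊤) , (∈⊤ , ∈⊤))

-- Colourings

-- Imported only here, since +_ makes sections such as (a +_) ambiguous.
open import Data.Integer using (+_)

-- Since `_/_` reduces to lowest terms, the inequality is first moved to unnormalised fractions,
-- where it is a comparison of cross products.
/-≤⇒*-≤ : ∀ k n d .{{_ : NonZero d}} → + k / 1 ℚ.≤ + n / d → d * k ≤ n
/-≤⇒*-≤ k n d@(suc d-1) k≤n/d = begin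
  d * k ≡⟨ *-comm d k ⟩
  k * d ≤⟨ ℤ.drop‿+≤+ (subst₂ ℤ._≤_ (sym (ℤ.pos-* k d)) (sym (ℤ.pos-* n 1)) (ℚᵘ.drop-*≤* unnormalised)) ⟩
  n * 1 ≡⟨ *-identityʳ n ⟩
  n     ∎
  where
  open ≤-Reasoning
  unnormalised : ℚᵘ.mkℚᵘ (+ k) 0 ℚᵘ.≤ ℚᵘ.mkℚᵘ (+ n) d-1
  unnormalised = ℚᵘ.≤-respˡ-≃ (ℚ.toℚᵘ-fromℚᵘ (ℚᵘ.mkℚᵘ (+ k) 0))
    (ℚᵘ.≤-respʳ-≃ (ℚ.toℚᵘ-fromℚᵘ (ℚᵘ.mkℚᵘ (+ n) d-1)) (ℚ.toℚᵘ-mono-≤ k≤n/d))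

-- The number of elements of `p` below `v`. It numbers the vertices of a part, in order to embed the
-- part into a host class.
rank : ∀ {k} → Subset k → Fin k → ℕ
rank (_       Vec.∷ p) zero    = 0
rank (inside  Vec.∷ p) (suc v) = suc (rank p v)
rank (outside Vec.∷ p) (suc v) = rank p v

rank<∣p∣ : ∀ {k} (p : Subset k) {v} → v ∈ p → rank p v < ∣ p ∣
rank<∣p∣ (inside  Vec.∷ p) here        = s≤s z≤n
rank<∣p∣ (inside  Vec.∷ p) (there v∈p) = s≤s (rank<∣p∣ p v∈p)
rank<∣p∣ (outside Vec.∷ p) (there v∈p) = rank<∣p∣ p v∈p

rank-injective : ∀ {k} (p : Subset k) {v u} → v ∈ p → u ∈ p → rank p v ≡ rank p u → v ≡ u
rank-injective (inside  Vec.∷ p) here        here        eq = refl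
rank-injective (inside  Vec.∷ p) (there v∈p) (there u∈p) eq = cong suc (rank-injective p v∈p u∈p (suc-injective eq))
rank-injective (outside Vec.∷ p) (there v∈p) (there u∈p) eq = cong suc (rank-injective p v∈p u∈p eq)

toEdge-just : ∀ H {u v} .(u<v : u Fin.< v) .(u~v : Graph.Adj H u v) → toEdge H (u , v) ≡ just (edge u v u<v u~v)
toEdge-just H {u} {v} u<v u~v with u <? v | Graph.adj? H u v
... | yes _    | yes _    = refl
... | no ¬u<v  | _        = contradiction (recompute (u <? v) u<v) ¬u<v
... | yes _    | no ¬u~v  = contradiction (recompute (Graph.adj? H u v) u~v) ¬u~v

toEdge-nothing : ∀ H {u v} → ¬ u Fin.< v → toEdge H (u , v) ≡ nothing
toEdge-nothing H {u} {v} ¬u<v with u <? v | Graph.adj? H u v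
... | yes u<v | _ = contradiction u<v ¬u<v
... | no _    | _ = refl

module Colours (H : Graph) (c : Coloring H) where
  open Graph H using (order; Adj; adj?; adj-sym; adj-irrefl)

  orientedColour : Vertex H → Vertex H → ℕ
  orientedColour u v = maybe c 0 (toEdge H (u , v))

  -- At most one of the two summands is not the default value 0.
  colour : Vertex H → Vertex H → ℕ
  colour u v = orientedColour u v + orientedColour v u

  colour-sym : ∀ u v → colour u v ≡ colour v u
  colour-sym u v = +-comm (orientedColour u v) (orientedColour v u)

  colour-edge : ∀ {u v} .(u<v : u Fin.< v) .(u~v : Adj u v) → colour u v ≡ c (edge u v u<v u~v)
  colour-edge {u} {v} u<v u~v = trans
    (cong₂ (λ e f → maybe c 0 e + maybe c 0 f) (toEdge-just H u<v u~v) (toEdge-nothing H (<-asym (recompute (u <? v) u<v))))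
    (+-identityʳ _)

  coloured? : ∀ i u v → Dec (u Fin.< v × Adj u v × colour u v ≡ i)
  coloured? i u v = (u <? v) ×-dec adj? u v ×-dec (colour u v ℕ.≟ i)

  ∑-coloured : ∀ i → ∑[ u ∈ allFin order ] ∑[ v ∈ allFin order ] ⟦ coloured? i u v ⟧ ≤ colorCount c i
  ∑-coloured i = begin
    ∑[ u ∈ allFin order ] ∑[ v ∈ allFin order ] ⟦ coloured? i u v ⟧
      ≤⟨ ∑-mono (allFin order) (λ u → ∑-mono (allFin order) λ v → ⟦⟧-≤ (coloured? i u v) (counted u v)) ⟩
    ∑[ u ∈ allFin order ] ∑[ v ∈ allFin order ] indicator (toEdge H (u , v))
      ≡⟨ ∑-cartesianProductWith _,_ (allFin order) (allFin order) (λ e → indicator (toEdge H e)) ⟨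
    ∑[ e ∈ cartesianProduct (allFin order) (allFin order) ] indicator (toEdge H e)
      ≡⟨ length-filter-mapMaybe (λ e → c e ℕ.≟ i) (toEdge H) (cartesianProduct (allFin order) (allFin order)) ⟨
    colorCount c i ∎
    where
    open ≤-Reasoning
    indicator = maybe (λ e → ⟦ c e ℕ.≟ i ⟧) 0
    counted : ∀ u v → u Fin.< v × Adj u v × colour u v ≡ i → 1 ≤ indicator (toEdge H (u , v))
    counted u v (u<v , u~v , eq) = subst (λ e → 1 ≤ indicator e) (sym (toEdge-just H u<v u~v))
      (⟦⟧-true (c (edge u v u<v u~v) ℕ.≟ i) (trans (sym (colour-edge u<v u~v)) eq))

  -- The edges at `u` form row `u` and column `u` of the matrix `h` of increasing pairs of colour
  -- `i`. The two meet only on the diagonal, where `h` vanishes, so together they are at most the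
  -- whole sum.
  ∑-star : ∀ i u → ∑[ v ∈ allFin order ] ⟦ adj? u v ×-dec (colour u v ℕ.≟ i) ⟧ ≤ colorCount c i
  ∑-star i u = begin
    ∑[ v ∈ V ] ⟦ adj? u v ×-dec (colour u v ℕ.≟ i) ⟧                               ≤⟨ ∑-mono V oriented ⟩
    ∑[ v ∈ V ] (h u v + h v u)                                                     ≡⟨ ∑-+ V (h u) (λ v → h v u) ⟩
    ∑[ v ∈ V ] h u v + ∑[ a ∈ V ] h a u
      ≡⟨ cong₂ _+_ (∑-≟-* u (λ a → ∑[ b ∈ V ] h a b)) (∑-cong V λ a → ∑-≟-* u (h a)) ⟩
    ∑[ a ∈ V ] (⟦ u ≟ a ⟧ * ∑[ b ∈ V ] h a b) + ∑[ a ∈ V ] ∑[ b ∈ V ] (⟦ u ≟ b ⟧ * h a b)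
      ≡⟨ ∑-+ V (λ a → ⟦ u ≟ a ⟧ * ∑[ b ∈ V ] h a b) (λ a → ∑[ b ∈ V ] (⟦ u ≟ b ⟧ * h a b)) ⟨
    ∑[ a ∈ V ] (⟦ u ≟ a ⟧ * ∑[ b ∈ V ] h a b + ∑[ b ∈ V ] (⟦ u ≟ b ⟧ * h a b))     ≤⟨ ∑-mono V row ⟩
    ∑[ a ∈ V ] ∑[ b ∈ V ] h a b                                                    ≤⟨ ∑-coloured i ⟩
    colorCount c i                                                                 ∎
    where
    open ≤-Reasoning
    V = allFin order
    h : Vertex H → Vertex H → ℕ
    h a b = ⟦ coloured? i a b ⟧
    oriented : ∀ v → ⟦ adj? u v ×-dec (colour u v ℕ.≟ i) ⟧ ≤ h u v + h v u
    oriented v = ⟦⟧-≤ (adj? u v ×-dec (colour u v ℕ.≟ i)) λ (u~v , eq) → by u~v eq (<-cmp u v)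
      where
      by : Adj u v → colour u v ≡ i → Tri (u Fin.< v) (u ≡ v) (v Fin.< u) → 1 ≤ h u v + h v u
      by u~v eq (tri< u<v _ _) = ≤-trans (⟦⟧-true (coloured? i u v) (u<v , u~v , eq)) (m≤m+n _ _)
      by u~v eq (tri≈ _ u≡v _) = contradiction u~v (adj-irrefl u≡v)
      by u~v eq (tri> _ _ v<u) = ≤-trans (⟦⟧-true (coloured? i v u) (v<u , adj-sym u~v , trans (colour-sym v u) eq)) (m≤n+m _ _)
    row : ∀ a → ⟦ u ≟ a ⟧ * ∑[ b ∈ V ] h a b + ∑[ b ∈ V ] (⟦ u ≟ b ⟧ * h a b) ≤ ∑[ b ∈ V ] h a b
    row a = begin
      ⟦ u ≟ a ⟧ * ∑[ b ∈ V ] h a b + ∑[ b ∈ V ] (⟦ u ≟ b ⟧ * h a b)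
        ≡⟨ cong (_+ ∑[ b ∈ V ] (⟦ u ≟ b ⟧ * h a b)) (∑-*ˡ V ⟦ u ≟ a ⟧ (h a)) ⟨
      ∑[ b ∈ V ] (⟦ u ≟ a ⟧ * h a b) + ∑[ b ∈ V ] (⟦ u ≟ b ⟧ * h a b)  ≡⟨ ∑-+ V (λ b → ⟦ u ≟ a ⟧ * h a b) (λ b → ⟦ u ≟ b ⟧ * h a b) ⟨
      ∑[ b ∈ V ] (⟦ u ≟ a ⟧ * h a b + ⟦ u ≟ b ⟧ * h a b)               ≤⟨ ∑-mono V (λ b → by b (u ≟ a) (u ≟ b)) ⟩
      ∑[ b ∈ V ] h a b                                                 ∎
      where
      by : ∀ b (p : Dec (u ≡ a)) (q : Dec (u ≡ b)) → ⟦ p ⟧ * h a b + ⟦ q ⟧ * h a b ≤ h a b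
      by b (yes refl) (yes refl) = ≤-reflexive (trans (cong₂ _+_ (cong (1 *_) none) (cong (1 *_) none)) (sym none))
        where
        none : h u u ≡ 0
        none = ⟦⟧-false (coloured? i u u) λ (u<u , _) → <-irrefl refl u<u
      by b (yes _) (no _)  = ≤-reflexive (trans (+-identityʳ _) (*-identityˡ _))
      by b (no _)  (yes _) = ≤-reflexive (*-identityˡ _)
      by b (no _)  (no _)  = z≤n

  edge-counted : ∀ e → 1 ≤ colorCount c (c e)
  edge-counted (edge u v u<v u~v) = begin
    1 ≤⟨ ⟦⟧-true (coloured? i u v) (recompute (u <? v) u<v , recompute (adj? u v) u~v , colour-edge u<v u~v) ⟩
    ⟦ coloured? i u v ⟧ ≤⟨ ∑-∈ (λ v → ⟦ coloured? i u v ⟧) (∈-allFin v) ⟩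
    ∑[ v ∈ allFin order ] ⟦ coloured? i u v ⟧ ≤⟨ ∑-∈ (λ u → ∑[ v ∈ allFin order ] ⟦ coloured? i u v ⟧) (∈-allFin u) ⟩
    ∑[ u ∈ allFin order ] ∑[ v ∈ allFin order ] ⟦ coloured? i u v ⟧ ≤⟨ ∑-coloured i ⟩
    colorCount c i ∎
    where
    open ≤-Reasoning
    i = c (edge u v u<v u~v)

-- Rainbow copies in the complete multipartite graph

K-edge : ∀ {m n} → 2 ≤ m → 1 ≤ n → Edge (K m ⊗ n)
K-edge {suc (suc m)} {suc n} (s≤s (s≤s _)) (s≤s _) = edge (place zero) (place (suc zero)) place-mono
  λ eq → contradiction (trans (sym (place-class zero)) (trans eq (place-class (suc zero)))) λ ()
  where
  place : Fin (suc (suc m)) → Fin (suc (suc m) * suc n)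
  place i = combine i zero
  place-mono : place zero Fin.< place (suc zero)
  place-mono = combine-monoˡ-< {suc (suc m)} {suc n} {zero} {suc zero} zero zero (s≤s z≤n)
  place-class : ∀ i → quotient {suc (suc m)} (suc n) (place i) ≡ i
  place-class i = cong proj₁ (remQuot-combine i zero)

theorem1p4 : (m n : ℕ) → m ≥ 2 → n ≥ 1 →
    (G : Graph) (Δ : ℕ) .{{_ : NonZero Δ}} → maxDegree G ≡ Δ →
    (U : Fin m → Subset (Graph.order G)) → IsPartition U →
    (∀ i → Independent G (U i)) →
    (∀ i → ∣ U i ∣ ≤ n) →
    (c : Coloring (K m ⊗ n)) →
    GloballyBounded (+ n / (110 * Δ ^ 2)) c →
    HasRainbowCopy G c
theorem1p4 m n 2≤m 1≤n G Δ maxDegree≡Δ U partition independent ∣U∣≤n c c-bounded = copy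
  where
  open Graph G using (order; Adj; adj?; adj-sym)
  H = K m ⊗ n
  open Colours H c

  class : Vertex G → Fin m
  class v = proj₁ (partition v)

  class-∈ : ∀ v → v ∈ U (class v)
  class-∈ v = proj₁ (proj₂ (partition v))

  bounded : ∀ i → 110 * Δ ^ 2 * colorCount c i ≤ n
  bounded i = /-≤⇒*-≤ (colorCount c i) n (110 * Δ ^ 2) (c-bounded i)

  -- The host has an edge, so some colour is used at least once, and boundedness forces
  -- `110 * Δ ^ 2 ≤ n`.
  30≤n : 30 ≤ n
  30≤n = begin
    30                                       ≤⟨ ≤ᵇ⇒≤ 30 110 _ ⟩
    110                                      ≤⟨ m≤m*n 110 (Δ ^ 2) {{m^n≢0 Δ 2}} ⟩
    110 * Δ ^ 2                              ≤⟨ m≤m*n (110 * Δ ^ 2) (colorCount c (c e)) {{>-nonZero (edge-counted e)}} ⟩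
    110 * Δ ^ 2 * colorCount c (c e)         ≤⟨ bounded (c e) ⟩
    n                                        ∎
    where
    open ≤-Reasoning
    e : Edge H
    e = K-edge 2≤m 1≤n

  part-size : ∀ i → ∑[ v ∈ allFin order ] ⟦ i ≟ class v ⟧ ≤ n
  part-size i = ≤-trans (∑-mono (allFin order) λ v → ⟦⟧-mono (i ≟ class v) (v ∈? U i) λ { refl → class-∈ v })
    (≤-trans (≤-reflexive (∑-∈? (U i))) (∣U∣≤n i))

  degree≤Δ : ∀ v → ∑[ u ∈ allFin order ] ⟦ adj? v u ⟧ ≤ Δ
  degree≤Δ v = subst₂ _≤_ (length-filter (adj? v) (allFin order)) maxDegree≡Δ
    (All.lookup (xs≤max 0 (map (degree G) (allFin order))) (∈-map⁺ (degree G) (∈-allFin v)))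

  class-adj : ∀ {v u} → Adj v u → class v ≢ class u
  class-adj {v} {u} v~u eq = independent (class v) (class-∈ v) (subst (λ i → u ∈ U i) (sym eq) (class-∈ u)) v~u

  open Placement G class (quotient {m} n) colour colour-sym using (valid?)
  open LocalLemma G class (quotient {m} n) colour colour-sym n Δ (colorCount c) 30≤n (>-nonZero⁻¹ Δ)
    (∑-quotient m n) part-size degree≤Δ class-adj ∑-coloured ∑-star bounded using (rainbow-placing)

  -- Placing each part into its host class by rank gives the valid placing from which the induction
  -- starts.
  position : Vertex G → Fin n
  position v = fromℕ< (<-≤-trans (rank<∣p∣ (U (class v)) (class-∈ v)) (∣U∣≤n (class v)))

  place : Vertex G → Fin (m * n)
  place v = combine (class v) (position v)

  place-class : ∀ v → quotient {m} n (place v) ≡ class v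
  place-class v = cong proj₁ (remQuot-combine (class v) (position v))

  place-injective : ∀ {v u} → place v ≡ place u → v ≡ u
  place-injective {v} {u} eq = rank-injective (U (class v)) (class-∈ v) (subst (λ i → u ∈ U i) (sym same) (class-∈ u))
    (trans (fromℕ<-injective _ _ _ _ (combine-injectiveʳ (class v) (position v) (class u) (position u) eq))
      (cong (λ i → rank (U i) u) (sym same)))
    where
    same : class v ≡ class u
    same = trans (sym (place-class v)) (trans (cong (quotient {m} n) eq) (place-class u))

  valid-exists : 1 ≤ # valid?
  valid-exists = #-inhabited valid? {tabulate place}
    ( (λ v u eq → place-injective (trans (sym (lookup∘tabulate place v)) (trans eq (lookup∘tabulate place u))))
    , (λ v → trans (cong (quotient {m} n) (lookup∘tabulate place v)) (place-class v)))

  copy : HasRainbowCopy G c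
  copy with φ , valid , no-clash ← rainbow-placing valid-exists = image , isomorphism , rainbow
    where
    image : Subgraph H
    image = record
      { Vert     = λ w → ∃[ v ] lookup φ v ≡ w
      ; Adj      = λ w w′ → ∃[ v ] ∃[ u ] (Adj v u × lookup φ v ≡ w × lookup φ u ≡ w′)
      ; adj-sym  = λ (v , u , v~u , p , q) → u , v , adj-sym v~u , q , p
      ; adj⇒Adj  = λ { (v , u , v~u , refl , refl) eq →
                     class-adj v~u (trans (sym (proj₂ valid v)) (trans eq (proj₂ valid u))) }
      ; adj⇒Vert = λ (v , u , _ , p , q) → (v , p) , (u , q)
      }
    isomorphism : Isomorphism G image
    isomorphism = record
      { to         = lookup φ
      ; to-Vert    = λ a → a , refl
      ; injective  = proj₁ valid _ _
      ; surjective = λ v → v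
      ; adj⇔       = λ {a} {b} → mk⇔ (λ a~b → a , b , a~b , refl , refl)
          λ (v , u , v~u , p , q) → subst₂ Adj (proj₁ valid v a p) (proj₁ valid u b q) v~u
      }
    rainbow : IsRainbow c image
    rainbow {edge _ _ p<q p~q} {edge _ _ p<q′ p~q′} (v , u , v~u , refl , refl) (x , y , x~y , refl , refl) e≢f ce≡cf =
      no-clash v u x y
        ( v~u , x~y , (λ { (refl , refl) → e≢f refl })
        -- Both edges store their smaller end first, so they cannot be reversals of each other.
        , (λ { (refl , refl) → <-asym (recompute (_ <? _) p<q) (recompute (_ <? _) p<q′) })
        , trans (colour-edge p<q p~q) (trans ce≡cf (sym (colour-edge p<q′ p~q′))))
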